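{- Let $r\ge 0$ be an integer and let $a,b$ be indeterminates. For all integers $n,m\ge 0$, $$\mathcal{G}_{a,b}(n+m;r)=\sum_{i=0}^n\sum_{j=0}^m \binom{n}{i}\,\mathcal{G}_{a,b}(m,j;r)\,\mathcal{G}_{a,b}(i;0)\prod_{\ell=0}^{n-i-1}\bigl(a\ell+a(m+r)+b(j+r)\bigr).$$
   Context: Write $[m]=\{1,\ldots,m\}$, $[0]=\varnothing$. A Lah distribution of $[m]$ into $\ell$ blocks is a partition of $[m]$ into $\ell$ non-empty, pairwise disjoint blocks in which the elements within each block are linearly ordered (the blocks themselves are not ordered). For integers $n,k,r$ with $0\le k\le n$ and $r\ge 0$, let $\mathcal{L}_r(n,k)$ be the set of Lah distributions of $[n+r]$ into $k+r$ blocks in which the elements of $[r]$ belong to distinct blocks. An element $i$ of a Lah distribution $\lambda$ is a record low if there is no element $j<i$ to the left of $i$ within its block. Let $rec^*(\lambda)$ be the number of record lows of $\lambda$ that are not the smallest element of their block, and let $nrec(\lambda)$ be the number of elements of the underlying set that are not record lows of $\lambda$. The generalized $r$-Lah number is the polynomial in indeterminates $a,b$ $$\mathcal{G}_{a,b}(n,k;r)=\sum_{\lambda\in\mathcal{L}_r(n,k)}a^{nrec(\lambda)}b^{rec^*(\lambda)},$$ with $\mathcal{G}_{a,b}(n,k;r)=0$ unless $0\le k\le n$ and $r\ge 0$. The row sums are $\mathcal{G}_{a,b}(n;r)=\sum_{k=0}^n\mathcal{G}_{a,b}(n,k;r)$ for $n\ge 0$. Empty sums are $0$ and empty products are $1$.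 -}

module Defs where

open import Algebra.Bundles using (CommutativeRing)
open import Data.Fin.Base using (toℕ)
open import Data.List.Base
  using (List; []; _∷_; [_]; applyUpTo; cartesianProductWith; concatMap; filter; foldr; length; map; takeWhile; upTo)
open import Data.List.Membership.DecPropositional using () renaming (_∈?_ to member?)
open import Data.List.Membership.Propositional using (_∈_; _∉_)
import Data.List.Properties as List
open import Data.List.Relation.Binary.Disjoint.Propositional using (Disjoint)
open import Data.List.Relation.Unary.All as All using (All; all?)
open import Data.List.Relation.Unary.AllPairs using (AllPairs; allPairs?)
open import Data.List.Relation.Unary.Any using (Any; any?)
open import Data.List.Relation.Unary.Unique.Propositional using (Unique)
open import Data.List.Relation.Unary.Unique.DecPropositional using (unique?)
open import Data.Nat.ListAction using (sum)
open import Data.Nat.Base as ℕ using (ℕ; zero; suc; _<_; _≤_)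
open import Data.Nat.Properties using (_≟_; _<?_; _≤?_)
open import Data.Product.Base using (_×_; _,_)
open import Data.Vec.Functional using (Vector)
open import Level using (Level)
open import Relation.Binary.PropositionalEquality.Core using (_≡_; _≢_)
open import Relation.Nullary.Decidable using (Dec; map′; ¬?; _×-dec_)
open import Relation.Nullary.Negation.Core using (¬_)

infix 4 _∈?_

_∈?_ : (i : ℕ) (xs : List ℕ) → Dec (i ∈ xs)
_∈?_ = member? _≟_

[1⋯_] : ℕ → List ℕ
[1⋯ m ] = applyUpTo suc m

-- A block is the list of its elements, read from left to right.
Block : Set
Block = List ℕ

-- For a non-empty block C this says min B < min C.
_Precedes_ : Block → Block → Set
B Precedes C = Any (λ i → All (i <_) C) B

-- The blocks of a distribution form a set.  As they are disjoint and non-empty,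
-- their minima are distinct, so each set of blocks has exactly one listing in
-- increasing order of minima; `ordered` selects that listing.
record IsLahDistribution (m ℓ : ℕ) (bs : List Block) : Set where
  constructor isLah
  field
    blockCount : length bs ≡ ℓ
    nonEmpty   : All (_≢ []) bs
    repFree    : All Unique bs
    disjoint   : AllPairs Disjoint bs
    within     : All (All (_∈ [1⋯ m ])) bs
    covers     : All (λ i → Any (i ∈_) bs) [1⋯ m ]
    ordered    : AllPairs _Precedes_ bs

disjoint? : (B C : Block) → Dec (Disjoint B C)
disjoint? B C =
  map′ (λ { d (i∈B , i∈C) → All.lookup d i∈B i∈C })
       (λ d → All.tabulate λ i∈B i∈C → d (i∈B , i∈C))
       (all? (λ i → ¬? (i ∈? C)) B)

isLahDistribution? : (m ℓ : ℕ) (bs : List Block) → Dec (IsLahDistribution m ℓ bs)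
isLahDistribution? m ℓ bs =
  map′ (λ { (p , q , s , t , u , v , w) → isLah p q s t u v w })
       (λ { (isLah p q s t u v w) → p , q , s , t , u , v , w })
       ( (length bs ≟ ℓ)
   ×-dec all? (λ B → ¬? (List.≡-dec _≟_ B [])) bs
   ×-dec all? (unique? _≟_) bs
   ×-dec allPairs? disjoint? bs
   ×-dec all? (all? (_∈? [1⋯ m ])) bs
   ×-dec all? (λ i → any? (i ∈?_) bs) [1⋯ m ]
   ×-dec allPairs? (λ B C → any? (λ i → all? (i <?_) C) B) bs )

words : {A : Set} → List A → ℕ → List (List A)
words alphabet zero    = [ [] ]
words alphabet (suc n) = cartesianProductWith _∷_ alphabet (words alphabet n)

-- A block has no repeated element, hence is a word over [m] of length at most m;
-- so the list being filtered contains every Lah distribution, exactly once.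
lahDistributions : ℕ → ℕ → List (List Block)
lahDistributions m ℓ =
  filter (isLahDistribution? m ℓ)
         (words (concatMap (words [1⋯ m ]) (upTo (suc m))) ℓ)

-- The elements of [r] belong to distinct blocks.
Separated : ℕ → List Block → Set
Separated r bs = AllPairs (λ i j → ¬ Any (λ B → i ∈ B × j ∈ B) bs) [1⋯ r ]

separated? : (r : ℕ) (bs : List Block) → Dec (Separated r bs)
separated? r bs =
  allPairs? (λ i j → ¬? (any? (λ B → (i ∈? B) ×-dec (j ∈? B)) bs)) [1⋯ r ]

𝓛 : (r n k : ℕ) → List (List Block)
𝓛 r n k = filter (separated? r) (lahDistributions (n ℕ.+ r) (k ℕ.+ r))

leftOf : ℕ → Block → List ℕ
leftOf i B = takeWhile (λ j → ¬? (j ≟ i)) B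

RecordLow : Block → ℕ → Set
RecordLow B i = ¬ Any (_< i) (leftOf i B)

recordLow? : (B : Block) (i : ℕ) → Dec (RecordLow B i)
recordLow? B i = ¬? (any? (_<? i) (leftOf i B))

Smallest : Block → ℕ → Set
Smallest B i = All (i ≤_) B

smallest? : (B : Block) (i : ℕ) → Dec (Smallest B i)
smallest? B i = all? (i ≤?_) B

nrec : List Block → ℕ
nrec bs = sum (map (λ B → length (filter (λ i → ¬? (recordLow? B i)) B)) bs)

rec* : List Block → ℕ
rec* bs =
  sum (map (λ B → length (filter (λ i → recordLow? B i ×-dec ¬? (smallest? B i)) B)) bs)

-- Identities between polynomials in the indeterminates a, b are stated as
-- identities for arbitrary elements a, b of an arbitrary commutative ring R;
-- R = ℤ[a,b] is an instance.
module GeneralizedLah {c ℓ : Level} (R : CommutativeRing c ℓ) where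

  open CommutativeRing R
  open import Algebra.Properties.Semiring.Sum semiring public
    using (sum-syntax; sum⁺-syntax)
  open import Algebra.Properties.Semiring.Exp semiring using (_^_)
  open import Algebra.Properties.Semiring.Mult semiring public
    using () renaming (_×_ to _·_)
  open import Algebra.Properties.CommutativeMonoid.Sum *-commutativeMonoid
    using () renaming (sum to product)

  infixl 10 product-syntax

  product-syntax : ∀ n → Vector Carrier n → Carrier
  product-syntax _ = product

  syntax product-syntax n (λ i → x) = ∏[ i < n ] x

  -- Zero for k > n, where 𝓛 r n k has no members.
  𝒢 : (a b : Carrier) (n k r : ℕ) → Carrier
  𝒢 a b n k r = foldr _+_ 0# (map (λ bs → a ^ nrec bs * b ^ rec* bs) (𝓛 r n k))

  rowSum : (a b : Carrier) (n r : ℕ) → Carrier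
  rowSum a b n r = ∑[ k ≤ n ] 𝒢 a b n (toℕ k) r

{-# OPTIONS --safe #-}

-- Inserting the new largest element m + 1 into a Lah distribution of [m] with k blocks gives
-- each Lah distribution of [m + 1] exactly once: it opens a block of its own, or becomes the
-- first element of a block (k ways, a further record low, weight b), or follows one of the m
-- elements (not a record low, weight a).  Hence
--   𝒢(n + 1, k + 1; r) = 𝒢(n, k; r) + (a (n + r) + b (k + 1 + r)) 𝒢(n, k + 1; r).
-- So the total weight Eₙ of n further insertions depends only on s = a (m + r) + b (j + r),
-- where j + r is the current number of blocks of an element of 𝓛 r m j:
--   E₀(s) = 1,   Eₙ₊₁(s) = Eₙ(s + a + b) + s Eₙ(s + a).
-- By induction on n, Eₙ(s + t) = ∑ᵢ (n C i) Eᵢ(t) ∏_{l < n − i} (a l + s); at t = 0, where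
-- Eᵢ(0) = 𝒢(i; 0), this turns 𝒢(n + m; r) = ∑ⱼ 𝒢(m, j; r) Eₙ(a (m + r) + b (j + r)) into
-- the theorem.

module Submission where

open import Defs
open import Algebra.Bundles using (CommutativeRing)
open import Data.Bool.Base using (if_then_else_)
open import Data.Fin.Base using (toℕ)
open import Data.Fin.Properties using (toℕ<n)
open import Data.List.Base
  using (List; []; _∷_; [_]; _++_; _∷ʳ_; applyUpTo; concat; concatMap; filter; foldr; length; map; upTo)
open import Data.List.Membership.Propositional using (_∈_; _∉_; find; lose)
open import Data.List.Membership.Propositional.Properties
open import Data.List.Membership.Propositional.Properties.WithK using (unique∧set⇒bag)
import Data.List.Properties as List
open import Data.List.Relation.Binary.BagAndSetEquality using (∼bag⇒↭)
open import Data.List.Relation.Binary.Disjoint.Propositional using (Disjoint)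
open import Data.List.Relation.Binary.Permutation.Propositional
  using (_↭_; ↭-refl; ↭-reflexive; ↭-prep; ↭-swap; ↭-sym; ↭-trans; ↭⇒↭ₛ)
open import Data.List.Relation.Binary.Permutation.Propositional.Properties
  using (↭-length; ∈-resp-↭; All-resp-↭; Any-resp-↭; drop-∷; shift; ∷↭∷ʳ; ++⁺ˡ; ++⁺ʳ; filter-↭)
import Data.List.Relation.Binary.Permutation.Setoid.Properties as PermutationSetoid
open import Data.List.Relation.Unary.All as All using (All; []; _∷_)
import Data.List.Relation.Unary.All.Properties as All
open import Data.List.Relation.Unary.AllPairs using (AllPairs; []; _∷_)
import Data.List.Relation.Unary.AllPairs.Properties as AllPairs
open import Data.List.Relation.Unary.Any as Any using (Any; here; there)
import Data.List.Relation.Unary.Any.Properties as Any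
open import Data.List.Relation.Unary.Unique.Propositional using (Unique)
import Data.List.Relation.Unary.Unique.Propositional.Properties as Unique
open import Data.Nat.Base as ℕ using (ℕ; zero; suc; _<_; _≤_; z≤n; s≤s; _∸_)
open import Data.Nat.Combinatorics using (_C_; nCk+nC[k+1]≡[n+1]C[k+1]; k>n⇒nCk≡0)
import Data.Nat.Properties as ℕ
open import Data.Product.Base using (∃; _×_; _,_; proj₁; proj₂)
open import Data.Sum.Base using (_⊎_; inj₁; inj₂)
open import Function.Base using (_∘_; _$_)
open import Function.Bundles using (_⇔_; mk⇔; module Equivalence)
open import Level using (Level; 0ℓ)
open import Relation.Binary.PropositionalEquality
  using (_≡_; _≢_; refl; sym; trans; cong; cong₂; subst; setoid)
open import Relation.Nullary.Decidable using (Dec; yes; no; does; ¬?; _×-dec_; dec-true; dec-false)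
open import Relation.Nullary.Negation using (¬_; contradiction)
open import Relation.Unary using (Pred; Decidable)

private
  variable
    X Y : Set
    i j r K M N x : ℕ
    B B′ : Block
    bs bs′ : List Block

-- Lists without repetition, and words over an alphabet

Unique-resp-↭ : {xs ys : List X} → xs ↭ ys → Unique xs → Unique ys
Unique-resp-↭ = PermutationSetoid.Unique-resp-↭ (setoid _) ∘ ↭⇒↭ₛ

unique-++⁻ : (xs : List X) {ys : List X} →
             Unique (xs ++ ys) → Unique xs × Unique ys × Disjoint xs ys
unique-++⁻ []       u = [] , u , λ ()
unique-++⁻ (x ∷ xs) (x∉ ∷ u) with unique-++⁻ xs u
... | uxs , uys , d = All.++⁻ˡ xs x∉ ∷ uxs , uys , λ
  { (here refl , v∈ys)  → All.lookup (All.++⁻ʳ xs x∉) v∈ys refl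
  ; (there v∈xs , v∈ys) → d (v∈xs , v∈ys) }

unique-concat⁻ : (xss : List (List X)) →
                 Unique (concat xss) → All Unique xss × AllPairs Disjoint xss
unique-concat⁻ []         _ = [] , []
unique-concat⁻ (xs ∷ xss) u with unique-++⁻ xs u
... | uxs , uxss , d with unique-concat⁻ xss uxss
...   | us , ds = uxs ∷ us ,
  All.tabulate (λ ys∈ {_} (v∈xs , v∈ys) → d (v∈xs , ∈-concat⁺′ v∈ys ys∈)) ∷ ds

-- The members of the lists f x are told apart by a left inverse g of f.
unique-concatMap : {f : X → List Y} (g : Y → X) (xs : List X) →
                   (∀ {x y} → x ∈ xs → y ∈ f x → g y ≡ x) →
                   (∀ {x} → x ∈ xs → Unique (f x)) →
                   Unique xs → Unique (concatMap f xs)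
unique-concatMap g []       _   _  _          = []
unique-concatMap {f = f} g (x ∷ xs) inv uf (x∉ ∷ uxs) =
  Unique.++⁺ (uf (here refl)) (unique-concatMap g xs (inv ∘ there) (uf ∘ there) uxs)
    λ (v∈fx , v∈) → let y , y∈ , v∈fy = find (∈-concatMap⁻ f {xs = xs} v∈) in
      All.lookup x∉ y∈ (trans (sym (inv (here refl) v∈fx)) (inv (there y∈) v∈fy))

words-complete : {xs ws : List X} → All (_∈ xs) ws → ws ∈ words xs (length ws)
words-complete []        = here refl
words-complete (w∈ ∷ ws) = ∈-cartesianProductWith⁺ _∷_ w∈ (words-complete ws)

words-length : (xs : List X) (n : ℕ) {ws : List X} → ws ∈ words xs n → length ws ≡ n
words-length xs zero    (here refl) = refl
words-length xs (suc n) ws∈ with ∈-cartesianProductWith⁻ _∷_ xs (words xs n) ws∈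
... | _ , _ , _ , vs∈ , refl = cong suc (words-length xs n vs∈)

words-unique : {xs : List X} → Unique xs → (n : ℕ) → Unique (words xs n)
words-unique u zero    = [] ∷ []
words-unique u (suc n) = Unique.cartesianProductWith⁺ _∷_ List.∷-injective u (words-unique u n)

-- The ground set, and Lah distributions as partitions of it

[1⋯]-unique : ∀ m → Unique [1⋯ m ]
[1⋯]-unique m = Unique.applyUpTo⁺₁ suc m λ i<j _ eq → ℕ.<⇒≢ i<j (ℕ.suc-injective eq)

∈-[1⋯]⁻ : i ∈ [1⋯ M ] → 1 ≤ i × i ≤ M
∈-[1⋯]⁻ i∈ with ∈-applyUpTo⁻ suc i∈
... | _ , i<M , refl = s≤s z≤n , i<M

∈-[1⋯]⁺ : 1 ≤ i → i ≤ M → i ∈ [1⋯ M ]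
∈-[1⋯]⁺ (s≤s _) i<M = ∈-applyUpTo⁺ suc i<M

[1⋯suc]-↭ : ∀ M → [1⋯ suc M ] ↭ suc M ∷ [1⋯ M ]
[1⋯suc]-↭ M = ↭-trans (↭-reflexive (sym (List.applyUpTo-∷ʳ suc M))) (↭-sym (∷↭∷ʳ (suc M) [1⋯ M ]))

-- Lah distributions of [M] with any number of blocks: that the blocks partition [M]
-- becomes the single condition `contents`.
record LahPartition (M : ℕ) (bs : List Block) : Set where
  constructor mkLah
  field
    contents : concat bs ↭ [1⋯ M ]
    nonEmpty : All (_≢ []) bs
    ordered  : AllPairs _Precedes_ bs

open LahPartition

-- Neither `concat bs` nor `[1⋯ M ]` repeats an element, and they have the same members; for such
-- lists this already gives a permutation.
toLahPartition : IsLahDistribution M K bs → length bs ≡ K × LahPartition M bs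
toLahPartition {M = M} {bs = bs} (isLah len ne rf dj wi co or) = len , record
  { contents = ∼bag⇒↭ (unique∧set⇒bag (Unique.concat⁺ rf dj) ([1⋯]-unique M)
      (mk⇔ (λ v∈ → let _ , v∈Y , Y∈ = ∈-concat⁻′ bs v∈ in All.lookup (All.lookup wi Y∈) v∈Y)
           (λ v∈ → ∈-concat⁺ (All.lookup co v∈))))
  ; nonEmpty = ne
  ; ordered  = or
  }

fromLahPartition : length bs ≡ K → LahPartition M bs → IsLahDistribution M K bs
fromLahPartition {bs} {M = M} len L = record
  { blockCount = len
  ; nonEmpty   = nonEmpty L
  ; repFree    = proj₁ parts
  ; disjoint   = proj₂ parts
  ; within     = All.concat⁻ (All.tabulate (∈-resp-↭ (contents L)))
  ; covers     = All.tabulate λ i∈ → ∈-concat⁻ bs (∈-resp-↭ (↭-sym (contents L)) i∈)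
  ; ordered    = ordered L
  }
  where
  parts : All Unique bs × AllPairs Disjoint bs
  parts = unique-concat⁻ bs (Unique-resp-↭ (↭-sym (contents L)) ([1⋯]-unique M))

elements-≤ : LahPartition M bs → All (All (_≤ M)) bs
elements-≤ L = All.concat⁻ (All.tabulate λ i∈ → proj₂ (∈-[1⋯]⁻ (∈-resp-↭ (contents L) i∈)))

elements-< : LahPartition M bs → All (All (_< suc M)) bs
elements-< = All.map (All.map s≤s) ∘ elements-≤

-- The alphabet of blocks is free of repetition, since the length of a block tells which
-- `words [1⋯ M ] n` it comes from; hence so are the words over it.
lahDistributions-unique : ∀ M K → Unique (lahDistributions M K)
lahDistributions-unique M K = Unique.filter⁺ (isLahDistribution? M K) $ words-unique
  (unique-concatMap length (upTo (suc M)) (λ {n} _ → words-length [1⋯ M ] n)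
    (λ {n} _ → words-unique ([1⋯]-unique M) n) (Unique.upTo⁺ (suc M)))
  K

∈-lahDistributions⁻ : ∀ M K → bs ∈ lahDistributions M K → length bs ≡ K × LahPartition M bs
∈-lahDistributions⁻ M K = toLahPartition ∘ proj₂ ∘
  ∈-filter⁻ (isLahDistribution? M K)
            {xs = words (concatMap (words [1⋯ M ]) (upTo (suc M))) K}

length-≤-concat : B ∈ bs → length B ≤ length (concat bs)
length-≤-concat {bs = D ∷ bs} (here refl) rewrite List.length-++ D {concat bs} = ℕ.m≤m+n _ _
length-≤-concat {bs = D ∷ bs} (there B∈)  rewrite List.length-++ D {concat bs} =
  ℕ.m≤n⇒m≤o+n (length D) (length-≤-concat B∈)

LahPartition-size : LahPartition M bs → length (concat bs) ≡ M
LahPartition-size {M = M} L = trans (↭-length (contents L)) (List.length-applyUpTo suc M)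

-- A block is no longer than `concat bs`, whose length is `M`, so it meets the length bound of the
-- enumerated alphabet.
∈-lahDistributions⁺ : ∀ M K → length bs ≡ K → LahPartition M bs → bs ∈ lahDistributions M K
∈-lahDistributions⁺ {bs = bs} M K refl L =
  ∈-filter⁺ (isLahDistribution? M K) (words-complete (All.tabulate block∈)) lah
  where
  lah : IsLahDistribution M K bs
  lah = fromLahPartition refl L

  block∈ : B ∈ bs → B ∈ concatMap (words [1⋯ M ]) (upTo (suc M))
  block∈ B∈ = ∈-concatMap⁺ (words [1⋯ M ]) $ lose
    (∈-upTo⁺ (s≤s (subst (_ ≤_) (LahPartition-size L) (length-≤-concat B∈))))
    (words-complete (All.lookup (IsLahDistribution.within lah) B∈))

-- Insertion of a new largest element

data Insertion (N : ℕ) : Block → Block → Set where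
  here  : Insertion N B (N ∷ B)
  there : Insertion N B B′ → Insertion N (x ∷ B) (x ∷ B′)

data BlockInsertion (N : ℕ) : List Block → List Block → Set where
  here  : Insertion N B B′ → BlockInsertion N (B ∷ bs) (B′ ∷ bs)
  there : BlockInsertion N bs bs′ → BlockInsertion N (B ∷ bs) (B ∷ bs′)

insert : ℕ → Block → List Block
insert N []      = [ [ N ] ]
insert N (x ∷ B) = (N ∷ x ∷ B) ∷ map (x ∷_) (insert N B)

-- Only existing blocks receive `N`, so the empty list yields nothing; a block of its own for `N` is
-- made by `_∷ʳ [ N ]`.
insertAny : ℕ → List Block → List (List Block)
insertAny N []       = []
insertAny N (B ∷ bs) = map (_∷ bs) (insert N B) ++ map (B ∷_) (insertAny N bs)

∈-insert⁻ : ∀ B → B′ ∈ insert N B → Insertion N B B′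
∈-insert⁻ []      (here refl) = here
∈-insert⁻ (x ∷ B) (here refl) = here
∈-insert⁻ (x ∷ B) (there B′∈) with ∈-map⁻ (x ∷_) B′∈
... | _ , D∈ , refl = there (∈-insert⁻ B D∈)

∈-insert⁺ : Insertion N B B′ → B′ ∈ insert N B
∈-insert⁺ {B = []}    here      = here refl
∈-insert⁺ {B = _ ∷ _} here      = here refl
∈-insert⁺             (there p) = there (∈-map⁺ _ (∈-insert⁺ p))

∈-insertAny⁻ : ∀ bs → bs′ ∈ insertAny N bs → BlockInsertion N bs bs′
∈-insertAny⁻ {N = N} (B ∷ bs) bs′∈ with ∈-++⁻ (map (_∷ bs) (insert N B)) bs′∈
... | inj₁ p with _ , B′∈ , refl ← ∈-map⁻ (_∷ bs) p = here (∈-insert⁻ B B′∈)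
... | inj₂ p with _ , cs∈ , refl ← ∈-map⁻ (B ∷_) p = there (∈-insertAny⁻ bs cs∈)

∈-insertAny⁺ : BlockInsertion N bs bs′ → bs′ ∈ insertAny N bs
∈-insertAny⁺ (here p)  = ∈-++⁺ˡ (∈-map⁺ _ (∈-insert⁺ p))
∈-insertAny⁺ (there p) = ∈-++⁺ʳ _ (∈-map⁺ _ (∈-insertAny⁺ p))

Insertion-↭ : Insertion N B B′ → B′ ↭ N ∷ B
Insertion-↭ here      = ↭-refl
Insertion-↭ (there p) = ↭-trans (↭-prep _ (Insertion-↭ p)) (↭-swap _ _ ↭-refl)

BlockInsertion-↭ : BlockInsertion N bs bs′ → concat bs′ ↭ N ∷ concat bs
BlockInsertion-↭ {bs = _ ∷ bs} (here p) = ++⁺ʳ (concat bs) (Insertion-↭ p)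
BlockInsertion-↭ {bs = B ∷ bs} (there p) =
  ↭-trans (++⁺ˡ B (BlockInsertion-↭ p)) (shift _ B (concat bs))

BlockInsertion-length : BlockInsertion N bs bs′ → length bs′ ≡ length bs
BlockInsertion-length (here _)  = refl
BlockInsertion-length (there p) = cong suc (BlockInsertion-length p)

∈⇒Insertion : N ∈ B′ → ∃ λ B → Insertion N B B′
∈⇒Insertion (here refl) = _ , here
∈⇒Insertion (there N∈)  = let _ , p = ∈⇒Insertion N∈ in _ , there p

∈⇒BlockInsertion : Any (N ∈_) bs′ → ∃ λ bs → BlockInsertion N bs bs′
∈⇒BlockInsertion (here N∈) = let _ , p = ∈⇒Insertion N∈ in _ , here p
∈⇒BlockInsertion (there q) = let _ , p = ∈⇒BlockInsertion q in _ , there p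

insert-length : ∀ N B → length (insert N B) ≡ suc (length B)
insert-length N []      = refl
insert-length N (x ∷ B) = cong suc (trans (List.length-map (x ∷_) (insert N B)) (insert-length N B))

insert-unique : N ∉ B → Unique (insert N B)
insert-unique {B = []}    _  = [] ∷ []
insert-unique {B = x ∷ B} N∉ =
  All.tabulate (λ D∈ eq → let _ , _ , eq′ = ∈-map⁻ (x ∷_) D∈ in
                 N∉ (here (List.∷-injectiveˡ (trans eq eq′))))
  ∷ Unique.map⁺ List.∷-injectiveʳ (insert-unique (N∉ ∘ there))

Insertion-irreflexive : ¬ Insertion N B B
Insertion-irreflexive p = ℕ.1+n≢n (sym (↭-length (Insertion-↭ p)))

insertAny-unique : All (N ∉_) bs → Unique (insertAny N bs)
insertAny-unique []                         = []
insertAny-unique {bs = B ∷ bs} (N∉B ∷ N∉bs) = Unique.++⁺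
  (Unique.map⁺ List.∷-injectiveˡ (insert-unique N∉B))
  (Unique.map⁺ List.∷-injectiveʳ (insertAny-unique N∉bs))
  -- A common member would begin with a block that is both `B` and `B` with `N` inserted, which the
  -- lengths exclude.
  λ (p , q) → let B′ , B′∈ , eq = ∈-map⁻ (_∷ bs) p ; _ , _ , eq′ = ∈-map⁻ (B ∷_) q in
    Insertion-irreflexive (subst (Insertion _ B) (List.∷-injectiveˡ (trans (sym eq) eq′))
                                 (∈-insert⁻ B B′∈))

-- Removal as the inverse of insertion

_≢?_ : ∀ x N → Dec (x ≢ N)
x ≢? N = ¬? (x ℕ.≟ N)

-- Supplies the left inverse that `unique-concatMap` asks for: deleting `N` shows which distribution
-- an insertion started from.
remove : ℕ → Block → Block
remove N = filter (_≢? N)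

remove-id : All (_< N) B → remove N B ≡ B
remove-id = List.filter-all (_≢? _) ∘ All.map ℕ.<⇒≢

remove-[_] : ∀ N → remove N [ N ] ≡ []
remove-[ N ] = List.filter-none (_≢? N) {xs = [ N ]} ((λ N≢N → N≢N refl) ∷ [])

Insertion-remove : All (_< N) B → Insertion N B B′ → remove N B′ ≡ B
Insertion-remove {N = N} {B = B} <N here =
  trans (List.filter-reject (_≢? N) {x = N} {xs = B} (λ N≢N → N≢N refl)) (remove-id <N)
Insertion-remove (x<N ∷ <N) (there p) =
  trans (List.filter-accept (_≢? _) (ℕ.<⇒≢ x<N)) (cong (_ ∷_) (Insertion-remove <N p))

removeAll-id : All (All (_< N)) bs → map (remove N) bs ≡ bs
removeAll-id []         = refl
removeAll-id (<N ∷ <Ns) = cong₂ _∷_ (remove-id <N) (removeAll-id <Ns)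

BlockInsertion-remove : All (All (_< N)) bs → BlockInsertion N bs bs′ → map (remove N) bs′ ≡ bs
BlockInsertion-remove (<N ∷ <Ns) (here p)  = cong₂ _∷_ (Insertion-remove <N p) (removeAll-id <Ns)
BlockInsertion-remove (<N ∷ <Ns) (there p) =
  cong₂ _∷_ (remove-id <N) (BlockInsertion-remove <Ns p)

-- Order and non-emptiness of the blocks under insertion

Insertion-All⁺ : {P : Pred ℕ 0ℓ} → Insertion N B B′ → P N → All P B → All P B′
Insertion-All⁺ p PN PC = All-resp-↭ (↭-sym (Insertion-↭ p)) (PN ∷ PC)

Insertion-All⁻ : {P : Pred ℕ 0ℓ} → Insertion N B B′ → All P B′ → All P B
Insertion-All⁻ p PC′ = All.tail (All-resp-↭ (Insertion-↭ p) PC′)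

Insertion-Any⁺ : {P : Pred ℕ 0ℓ} → Insertion N B B′ → Any P B → Any P B′
Insertion-Any⁺ p PC = Any-resp-↭ (↭-sym (Insertion-↭ p)) (there PC)

Insertion-Any⁻ : {P : Pred ℕ 0ℓ} → Insertion N B B′ → ¬ P N → Any P B′ → Any P B
Insertion-Any⁻ p ¬PN PC′ with Any-resp-↭ (Insertion-↭ p) PC′
... | here PN  = contradiction PN ¬PN
... | there PC = PC

precedes-insertˡ : {D : Block} → Insertion N B B′ → B Precedes D → B′ Precedes D
precedes-insertˡ = Insertion-Any⁺

-- The element of `D` that witnesses `D Precedes B` is itself below `N`, so it stays below every
-- entry of `B′`.
precedes-insertʳ : {D : Block} → All (_< N) D → Insertion N B B′ → D Precedes B → D Precedes B′
precedes-insertʳ <N p D≺B = let i , i∈D , i<B = find D≺B in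
  lose i∈D (Insertion-All⁺ p (All.lookup <N i∈D) i<B)

not-above : B ≢ [] → All (_≤ N) B → ¬ All (N <_) B
not-above {[]}    B≢[] _         _         = B≢[] refl
not-above {_ ∷ _} _    (x≤N ∷ _) (N<x ∷ _) = ℕ.<⇒≱ N<x x≤N

-- The witness in `B′` cannot be `N`, as `D` is non-empty and lies below `N`; so it is already in
-- `B`.
precedes-removeˡ : {D : Block} → D ≢ [] → All (_< N) D →
                   Insertion N B B′ → B′ Precedes D → B Precedes D
precedes-removeˡ D≢[] <N p = Insertion-Any⁻ p (not-above D≢[] (All.map ℕ.<⇒≤ <N))

precedes-removeʳ : {D : Block} → Insertion N B B′ → D Precedes B′ → D Precedes B
precedes-removeʳ p = Any.map (Insertion-All⁻ p)

precedesAll-insert : {D : Block} → All (_< N) D → BlockInsertion N bs bs′ →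
                     All (D Precedes_) bs → All (D Precedes_) bs′
precedesAll-insert <N (here p)  (D≺B ∷ ≺s) = precedes-insertʳ <N p D≺B ∷ ≺s
precedesAll-insert <N (there p) (D≺B ∷ ≺s) = D≺B ∷ precedesAll-insert <N p ≺s

precedesAll-remove : {D : Block} → BlockInsertion N bs bs′ →
                     All (D Precedes_) bs′ → All (D Precedes_) bs
precedesAll-remove {D = D} (here p)  (D≺B ∷ ≺s) = precedes-removeʳ {D = D} p D≺B ∷ ≺s
precedesAll-remove {D = D} (there p) (D≺B ∷ ≺s) = D≺B ∷ precedesAll-remove {D = D} p ≺s

ordered-insert : All (All (_< N)) bs → BlockInsertion N bs bs′ →
                 AllPairs _Precedes_ bs → AllPairs _Precedes_ bs′
ordered-insert (<N ∷ <Ns) (here p)  (≺s ∷ o) = All.map (precedes-insertˡ p) ≺s ∷ o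
ordered-insert (<N ∷ <Ns) (there p) (≺s ∷ o) = precedesAll-insert <N p ≺s ∷ ordered-insert <Ns p o

ordered-remove : All (_≢ []) bs → All (All (_< N)) bs → BlockInsertion N bs bs′ →
                 AllPairs _Precedes_ bs′ → AllPairs _Precedes_ bs
ordered-remove (_ ∷ ne) (_ ∷ <Ns) (here p) (≺s ∷ o) =
  All.zipWith (λ ((≢[] , <N) , ≺) → precedes-removeˡ ≢[] <N p ≺) (All.zip (ne , <Ns) , ≺s) ∷ o
ordered-remove {bs = B ∷ _} (_ ∷ ne) (_ ∷ <Ns) (there p) (≺s ∷ o) =
  precedesAll-remove {D = B} p ≺s ∷ ordered-remove ne <Ns p o

Insertion-nonEmpty : Insertion N B B′ → B′ ≢ []
Insertion-nonEmpty here      ()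
Insertion-nonEmpty (there _) ()

nonEmpty-insert : BlockInsertion N bs bs′ → All (_≢ []) bs → All (_≢ []) bs′
nonEmpty-insert (here p)  (_ ∷ ne)   = Insertion-nonEmpty p ∷ ne
nonEmpty-insert (there p) (≢[] ∷ ne) = ≢[] ∷ nonEmpty-insert p ne

-- Taking `N` out empties a block only if that block is `[ N ]`, which the hypothesis excludes.
nonEmpty-remove : [ N ] ∉ bs′ → BlockInsertion N bs bs′ → All (_≢ []) bs′ → All (_≢ []) bs
nonEmpty-remove N∉ (here {B = []}    here) _        = contradiction (here refl) N∉
nonEmpty-remove N∉ (here {B = _ ∷ _} p)    (_ ∷ ne) = (λ ()) ∷ ne
nonEmpty-remove N∉ (there p)               (≢[] ∷ ne) = ≢[] ∷ nonEmpty-remove (N∉ ∘ there) p ne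

-- Lah distributions of [M + 1] from those of [M]

LahPartition-insert : BlockInsertion (suc M) bs bs′ → LahPartition M bs → LahPartition (suc M) bs′
LahPartition-insert {M = M} p L = record
  { contents = ↭-trans (BlockInsertion-↭ p)
                 (↭-trans (↭-prep (suc M) (contents L)) (↭-sym ([1⋯suc]-↭ M)))
  ; nonEmpty = nonEmpty-insert p (nonEmpty L)
  ; ordered  = ordered-insert (elements-< L) p (ordered L)
  }

LahPartition-remove : [ suc M ] ∉ bs′ → BlockInsertion (suc M) bs bs′ →
                      LahPartition (suc M) bs′ → LahPartition M bs
LahPartition-remove {M = M} {bs = bs} N∉ p L = record
  { contents = contents′
  ; nonEmpty = nonEmpty′
  ; ordered  = ordered-remove nonEmpty′
      (All.concat⁻ (All.tabulate λ i∈ → s≤s (proj₂ (∈-[1⋯]⁻ (∈-resp-↭ contents′ i∈)))))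
      p (ordered L)
  }
  where
  contents′ : concat bs ↭ [1⋯ M ]
  contents′ = drop-∷ (↭-trans (↭-sym (BlockInsertion-↭ p)) (↭-trans (contents L) ([1⋯suc]-↭ M)))

  nonEmpty′ : All (_≢ []) bs
  nonEmpty′ = nonEmpty-remove N∉ p (nonEmpty L)

concat-∷ʳ-↭ : ∀ N (bs : List Block) → concat (bs ∷ʳ [ N ]) ↭ N ∷ concat bs
concat-∷ʳ-↭ N bs = ↭-trans (↭-reflexive (sym (List.concat-++ bs [ [ N ] ]))) (↭-sym (∷↭∷ʳ N (concat bs)))

precedes-singleton : B ≢ [] → All (_< N) B → B Precedes [ N ]
precedes-singleton {[]}    B≢[] _         = contradiction refl B≢[]
precedes-singleton {_ ∷ _} _    (x<N ∷ _) = here (x<N ∷ [])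

-- Every old block contains an element below `suc M`, so the listing by increasing minima puts the
-- new block last.
LahPartition-append : LahPartition M bs → LahPartition (suc M) (bs ∷ʳ [ suc M ])
LahPartition-append {M = M} {bs = bs} L = record
  { contents = ↭-trans (concat-∷ʳ-↭ (suc M) bs)
                 (↭-trans (↭-prep (suc M) (contents L)) (↭-sym ([1⋯suc]-↭ M)))
  ; nonEmpty = All.∷ʳ⁺ (nonEmpty L) λ ()
  ; ordered  = AllPairs.++⁺ (ordered L) ([] ∷ [])
      (All.zipWith (λ (≢[] , <N) → precedes-singleton ≢[] <N ∷ []) (nonEmpty L , elements-< L))
  }

AllPairs-++⁻ : {R : X → X → Set} (xs : List X) {ys : List X} →
               AllPairs R (xs ++ ys) → AllPairs R xs × AllPairs R ys
AllPairs-++⁻ []       Rys       = [] , Rys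
AllPairs-++⁻ (x ∷ xs) (Rx ∷ Rs) = let Rxs , Rys = AllPairs-++⁻ xs Rs in All.++⁻ˡ xs Rx ∷ Rxs , Rys

LahPartition-unappend : LahPartition (suc M) (bs ∷ʳ [ suc M ]) → LahPartition M bs
LahPartition-unappend {M = M} {bs = bs} L = record
  { contents = drop-∷ (↭-trans (↭-sym (concat-∷ʳ-↭ (suc M) bs)) (↭-trans (contents L) ([1⋯suc]-↭ M)))
  ; nonEmpty = All.++⁻ˡ bs (nonEmpty L)
  ; ordered  = proj₁ (AllPairs-++⁻ bs (ordered L))
  }

-- A block listed after `[ M ]` would be non-empty with all its elements above `M`.
singleton-last : ∀ bs {cs} → LahPartition M (bs ++ [ M ] ∷ cs) → cs ≡ []
singleton-last bs {[]}     L = refl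
singleton-last bs {B ∷ cs} L
  with (here M<B ∷ _) ∷ _ ← proj₂ (AllPairs-++⁻ bs (ordered L))
     | _ ∷ B≢[] ∷ _ ← All.++⁻ʳ bs (nonEmpty L)
     | _ ∷ B≤M ∷ _ ← All.++⁻ʳ bs (elements-≤ L) = contradiction M<B (not-above B≢[] B≤M)

-- The cases are whether `suc M` forms a block of its own. If so, that block is the last one; if
-- not, taking `suc M` out leaves no empty block.
LahPartition-suc⁻ : LahPartition (suc M) bs′ →
                    (∃ λ bs → LahPartition M bs × bs′ ≡ bs ∷ʳ [ suc M ]) ⊎
                    (∃ λ bs → LahPartition M bs × BlockInsertion (suc M) bs bs′)
LahPartition-suc⁻ {M = M} {bs′ = bs′} L with Any.any? (List.≡-dec ℕ._≟_ [ suc M ]) bs′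
... | yes N∈ with bs , cs , refl ← ∈-∃++ N∈ with refl ← singleton-last bs L =
  inj₁ (bs , LahPartition-unappend L , refl)
... | no N∉ with bs , p ← ∈⇒BlockInsertion (∈-concat⁻ bs′
                  (∈-resp-↭ (↭-sym (contents L)) (∈-[1⋯]⁺ (s≤s z≤n) ℕ.≤-refl))) =
  inj₂ (bs , LahPartition-remove N∉ p L , p)

length-∷ʳ : (xs : List X) (x : X) → length (xs ∷ʳ x) ≡ suc (length xs)
length-∷ʳ xs x = sym (↭-length (∷↭∷ʳ x xs))

-- Both sides are free of repetition and have the same members, hence are permutations of each
-- other. Among the insertions, `map (remove top)` recovers the distribution each came from.
lahDistributions-suc : ∀ M K →
  lahDistributions (suc M) (suc K) ↭
  map (_∷ʳ [ suc M ]) (lahDistributions M K) ++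
  concatMap (insertAny (suc M)) (lahDistributions M (suc K))
lahDistributions-suc M K = ∼bag⇒↭ (unique∧set⇒bag (lahDistributions-unique (suc M) (suc K))
  (Unique.++⁺ (Unique.map⁺ (λ {bs} {cs} → List.∷ʳ-injectiveˡ bs cs) (lahDistributions-unique M K))
              (unique-concatMap (map (remove top)) (lahDistributions M (suc K))
                 (λ {bs} bs∈ → BlockInsertion-remove (elements-< (lah∈ (suc K) bs∈)) ∘ ∈-insertAny⁻ bs)
                 (λ bs∈ → insertAny-unique (All.map (λ <top top∈ → ℕ.<-irrefl refl (All.lookup <top top∈))
                                                    (elements-< (lah∈ (suc K) bs∈))))
                 (lahDistributions-unique M (suc K)))
              (λ (p , q) → separate p q))
  (mk⇔ to from))
  where
  top = suc M
  appended = map (_∷ʳ [ top ]) (lahDistributions M K)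
  inserted = concatMap (insertAny top) (lahDistributions M (suc K))

  lah∈ : ∀ K → bs ∈ lahDistributions M K → LahPartition M bs
  lah∈ K = proj₂ ∘ ∈-lahDistributions⁻ M K

  ∈-inserted⁻ : bs′ ∈ inserted → ∃ λ bs → bs ∈ lahDistributions M (suc K) × BlockInsertion top bs bs′
  ∈-inserted⁻ bs′∈ =
    let bs , bs∈ , p = find (∈-concatMap⁻ (insertAny top) {xs = lahDistributions M (suc K)} bs′∈)
    in bs , bs∈ , ∈-insertAny⁻ bs p

  -- Removing top from a member of `appended` leaves an empty block.
  separate : bs′ ∈ appended → ¬ bs′ ∈ inserted
  separate p q with cs , _ , refl ← ∈-map⁻ (_∷ʳ [ top ]) p | bs , bs∈ , ins ← ∈-inserted⁻ q =
    All.lookup (nonEmpty L) []∈ refl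
    where
    L : LahPartition M bs
    L = lah∈ (suc K) bs∈
    []∈ : [] ∈ bs
    []∈ = subst ([] ∈_) (BlockInsertion-remove (elements-< L) ins)
            (subst (_∈ map (remove top) (cs ∷ʳ [ top ])) remove-[ top ]
              (∈-map⁺ (remove top) (∈-++⁺ʳ cs (here refl))))

  to : bs′ ∈ lahDistributions top (suc K) → bs′ ∈ appended ++ inserted
  to bs′∈ with len , L′ ← ∈-lahDistributions⁻ top (suc K) bs′∈ with LahPartition-suc⁻ L′
  ... | inj₁ (bs , L , refl) = ∈-++⁺ˡ (∈-map⁺ (_∷ʳ [ top ])
    (∈-lahDistributions⁺ M K (ℕ.suc-injective (trans (sym (length-∷ʳ bs [ top ])) len)) L))
  ... | inj₂ (bs , L , p) = ∈-++⁺ʳ appended (∈-concatMap⁺ (insertAny top)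
    (lose (∈-lahDistributions⁺ M (suc K) (trans (sym (BlockInsertion-length p)) len) L)
          (∈-insertAny⁺ p)))

  from : bs′ ∈ appended ++ inserted → bs′ ∈ lahDistributions top (suc K)
  from bs′∈ with ∈-++⁻ appended bs′∈
  ... | inj₁ p with bs , bs∈ , refl ← ∈-map⁻ (_∷ʳ [ top ]) p =
    let len , L = ∈-lahDistributions⁻ M K bs∈ in
    ∈-lahDistributions⁺ top (suc K) (trans (length-∷ʳ bs [ top ]) (cong suc len)) (LahPartition-append L)
  ... | inj₂ q with bs , bs∈ , p ← ∈-inserted⁻ q =
    let len , L = ∈-lahDistributions⁻ M (suc K) bs∈ in
    ∈-lahDistributions⁺ top (suc K) (trans (BlockInsertion-length p) len) (LahPartition-insert p L)

-- Separation and insertion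

Together : ℕ → ℕ → List Block → Set
Together i j = Any (λ B → i ∈ B × j ∈ B)

AllPairs-applyUpTo⁻ : {R : X → X → Set} (f : ℕ → X) (n : ℕ) → AllPairs R (applyUpTo f n) →
                      i < j → j < n → R (f i) (f j)
AllPairs-applyUpTo⁻ {i = zero}  {j = suc _} f (suc n) (Rs ∷ _) _ (s≤s j<n) =
  All.applyUpTo⁻ (f ∘ suc) n Rs j<n
AllPairs-applyUpTo⁻ {i = suc _} {j = suc _} f (suc n) (_ ∷ Rss) (s≤s i<j) (s≤s j<n) =
  AllPairs-applyUpTo⁻ (f ∘ suc) n Rss i<j j<n

separated⁺ : ∀ r → (∀ {i j} → i < j → j ≤ r → ¬ Together i j bs) → Separated r bs
separated⁺ r apart = AllPairs.applyUpTo⁺₁ suc r λ i<j j<r → apart (s≤s i<j) j<r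

separated⁻ : ∀ r → Separated r bs → 1 ≤ i → i < j → j ≤ r → ¬ Together i j bs
separated⁻ r sep (s≤s z≤n) (s≤s i<j) j<r = AllPairs-applyUpTo⁻ suc r sep i<j j<r

-- Separation is a negative condition, so it is carried backwards along a map of `Together`. The
-- bounds on `i` and `j` are handed on because they tell `i` and `j` from a new element or from each
-- other.
separated-map : ∀ r → (∀ {i j} → i < j → j ≤ r → Together i j bs′ → Together i j bs) →
                Separated r bs → Separated r bs′
separated-map r f sep = AllPairs.applyUpTo⁺₁ suc r λ i<j j<r →
  AllPairs-applyUpTo⁻ suc r sep i<j j<r ∘ f (s≤s i<j) j<r

together-insert : BlockInsertion N bs bs′ → Together i j bs → Together i j bs′
together-insert (here p)  (here (i∈ , j∈)) = here (Insertion-Any⁺ p i∈ , Insertion-Any⁺ p j∈)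
together-insert (here p)  (there t)        = there t
together-insert (there p) (here ∈B)        = here ∈B
together-insert (there p) (there t)        = there (together-insert p t)

together-remove : i ≢ N → j ≢ N → BlockInsertion N bs bs′ → Together i j bs′ → Together i j bs
together-remove i≢N j≢N (here p) (here (i∈ , j∈)) =
  here (Insertion-Any⁻ p i≢N i∈ , Insertion-Any⁻ p j≢N j∈)
together-remove i≢N j≢N (here p)  (there t) = there t
together-remove i≢N j≢N (there p) (here ∈B) = here ∈B
together-remove i≢N j≢N (there p) (there t) = there (together-remove i≢N j≢N p t)

separated-insert : r < N → BlockInsertion N bs bs′ → Separated r bs → Separated r bs′
separated-insert {r = r} r<N p = separated-map r λ i<j j≤r →
  together-remove (ℕ.<⇒≢ (ℕ.<-trans i<j (ℕ.≤-<-trans j≤r r<N))) (ℕ.<⇒≢ (ℕ.≤-<-trans j≤r r<N)) p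

separated-remove : BlockInsertion N bs bs′ → Separated r bs′ → Separated r bs
separated-remove {r = r} p = separated-map r λ _ _ → together-insert p

-- The added block has a single element, so it cannot hold two numbers `i < j`.
separated-append : Separated r bs → Separated r (bs ∷ʳ [ N ])
separated-append {r = r} {bs = bs} = separated-map r λ i<j _ t → case-++ i<j (Any.++⁻ bs t)
  where
  case-++ : ∀ {N} → i < j → Together i j bs ⊎ Together i j [ [ N ] ] → Together i j bs
  case-++ _   (inj₁ t)                              = t
  case-++ i<i (inj₂ (here (here refl , here refl))) = contradiction i<i (ℕ.<-irrefl refl)

separated-unappend : ∀ bs → Separated r (bs ∷ʳ [ N ]) → Separated r bs
separated-unappend {r = r} bs = separated-map r λ _ _ → Any.++⁺ˡ

-- The receiving block is non-empty, so `N` joins an element that is already there.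
insertion-meets : All (_≢ []) bs → All (All (_∈ [1⋯ M ])) bs → BlockInsertion N bs bs′ →
                  ∃ λ i → i ∈ [1⋯ M ] × Together i N bs′
insertion-meets {bs = [] ∷ _} (≢[] ∷ _) _ (here _) = contradiction refl ≢[]
insertion-meets {bs = (x ∷ B) ∷ _} _ ((x∈ ∷ _) ∷ _) (here p) =
  x , x∈ , here (Insertion-Any⁺ p (here refl) , ∈-resp-↭ (↭-sym (Insertion-↭ p)) (here refl))
insertion-meets (_ ∷ ne) (_ ∷ ∈s) (there p) =
  let i , i∈ , t = insertion-meets ne ∈s p in i , i∈ , there t

-- For `M < r` both `suc M` and any element that it joins belong to `[r]`. So, while `[r]` is being
-- placed, each element has to open a block.
not-separated-insert : LahPartition M bs → BlockInsertion (suc M) bs bs′ → M < r → ¬ Separated r bs′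
not-separated-insert {r = r} L p M<r sep
  with i , i∈ , t ← insertion-meets (nonEmpty L) (All.concat⁻ (All.tabulate (∈-resp-↭ (contents L)))) p
  with 1≤i , i≤M ← ∈-[1⋯]⁻ i∈ = separated⁻ r sep 1≤i (s≤s i≤M) M<r t

-- Statistics of a block

nonLow? : (B : Block) → Decidable (λ i → ¬ RecordLow B i)
nonLow? B i = ¬? (recordLow? B i)

low*? : (B : Block) → Decidable (λ i → RecordLow B i × ¬ Smallest B i)
low*? B i = recordLow? B i ×-dec ¬? (smallest? B i)

nonLows lows* : Block → ℕ
nonLows B = length (filter (nonLow? B) B)
lows*   B = length (filter (low*? B) B)

filter-⇔ : {P Q : Pred X 0ℓ} (P? : Decidable P) (Q? : Decidable Q) {xs : List X} →
           All (λ x → P x ⇔ Q x) xs → filter P? xs ≡ filter Q? xs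
filter-⇔ P? Q? [] = refl
filter-⇔ P? Q? {x ∷ xs} (P⇔Q ∷ rest) with P? x | Q? x
... | yes _  | yes _  = cong (x ∷_) (filter-⇔ P? Q? rest)
... | no  _  | no  _  = filter-⇔ P? Q? rest
... | yes Px | no ¬Qx = contradiction (Equivalence.to P⇔Q Px) ¬Qx
... | no ¬Px | yes Qx = contradiction (Equivalence.from P⇔Q Qx) ¬Px

module _ {P Q : Pred ℕ 0ℓ} (P? : Decidable P) (Q? : Decidable Q)
         (p : Insertion N B B′) (P⇔Q : All (λ i → P i ⇔ Q i) B) where

  private
    filter-insert : length (filter Q? B′) ≡ length (filter Q? (N ∷ B))
    filter-insert = ↭-length (filter-↭ Q? (Insertion-↭ p))

    filter-P≡Q : filter P? B ≡ filter Q? B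
    filter-P≡Q = filter-⇔ P? Q? P⇔Q

  -- The property counted may refer to the block, hence `P` for `B` and `Q` for `B′`. As they agree
  -- on the elements of `B`, only the new element can change the count.
  count-accept : Q N → length (filter Q? B′) ≡ suc (length (filter P? B))
  count-accept QN = trans filter-insert
    (cong length (trans (List.filter-accept Q? QN) (cong (N ∷_) (sym filter-P≡Q))))

  count-reject : ¬ Q N → length (filter Q? B′) ≡ length (filter P? B)
  count-reject ¬QN = trans filter-insert
    (cong length (trans (List.filter-reject Q? ¬QN) (sym filter-P≡Q)))

leftOf-stop : ∀ i B → leftOf i (i ∷ B) ≡ []
leftOf-stop i B rewrite dec-true (i ℕ.≟ i) refl = refl

leftOf-step : ∀ B → x ≢ i → leftOf i (x ∷ B) ≡ x ∷ leftOf i B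
leftOf-step {x = x} {i = i} B x≢i rewrite dec-false (x ℕ.≟ i) x≢i = refl

-- A new element to the left of `i` is not below `i`, since `i < N`; so the record lows among the
-- old elements stay the same.
leftOf-insert : Insertion N B B′ → i < N → Any (_< i) (leftOf i B) ⇔ Any (_< i) (leftOf i B′)
leftOf-insert {N = N} {B = B} {i = i} here i<N
  rewrite leftOf-step B (ℕ.<⇒≢ i<N ∘ sym) =
  mk⇔ there λ { (here N<i) → contradiction i<N (ℕ.<⇒≯ N<i) ; (there q) → q }
leftOf-insert {i = i} (there {B = B} {B′ = B′} {x = x} p) i<N with x ℕ.≟ i
... | yes refl rewrite leftOf-stop x B | leftOf-stop x B′ = mk⇔ (λ ()) (λ ())
... | no x≢i rewrite leftOf-step B x≢i | leftOf-step B′ x≢i =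
  mk⇔ (λ { (here x<i) → here x<i ; (there q) → there (to q) })
      (λ { (here x<i) → here x<i ; (there q) → there (from q) })
  where open Equivalence (leftOf-insert p i<N)

recordLow-insert : Insertion N B B′ → i < N → RecordLow B i ⇔ RecordLow B′ i
recordLow-insert p i<N = mk⇔ (_∘ from) (_∘ to)
  where open Equivalence (leftOf-insert p i<N)

smallest-insert : Insertion N B B′ → i < N → Smallest B i ⇔ Smallest B′ i
smallest-insert p i<N = mk⇔ (Insertion-All⁺ p (ℕ.<⇒≤ i<N)) (Insertion-All⁻ p)

nonLow-insert : Insertion N B B′ → i < N → (¬ RecordLow B i) ⇔ (¬ RecordLow B′ i)
nonLow-insert p i<N = mk⇔ (_∘ from) (_∘ to)
  where open Equivalence (recordLow-insert p i<N)

low*-insert : Insertion N B B′ → i < N →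
              (RecordLow B i × ¬ Smallest B i) ⇔ (RecordLow B′ i × ¬ Smallest B′ i)
low*-insert p i<N = mk⇔ (λ (low , ¬sm) → R.to low , ¬sm ∘ S.from) (λ (low , ¬sm) → R.from low , ¬sm ∘ S.to)
  where
  module R = Equivalence (recordLow-insert p i<N)
  module S = Equivalence (smallest-insert p i<N)

recordLow-head : ∀ N B → RecordLow (N ∷ B) N
recordLow-head N B rewrite leftOf-stop N B = λ ()

not-recordLow : x < N → ¬ RecordLow (x ∷ B) N
not-recordLow {B = B} x<N low rewrite leftOf-step B (ℕ.<⇒≢ x<N) = low (here x<N)

module _ (<N : All (_< N) (x ∷ B)) where

  private
    x<N : x < N
    x<N = All.head <N

    nonLow-⇔ : Insertion N (x ∷ B) B′ → All (λ i → (¬ RecordLow (x ∷ B) i) ⇔ (¬ RecordLow B′ i)) (x ∷ B)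
    nonLow-⇔ p = All.map (nonLow-insert p) <N

    low*-⇔ : Insertion N (x ∷ B) B′ →
             All (λ i → (RecordLow (x ∷ B) i × ¬ Smallest (x ∷ B) i) ⇔
                        (RecordLow B′ i × ¬ Smallest B′ i)) (x ∷ B)
    low*-⇔ p = All.map (low*-insert p) <N

  nonLows-front : nonLows (N ∷ x ∷ B) ≡ nonLows (x ∷ B)
  nonLows-front = count-reject (nonLow? (x ∷ B)) (nonLow? (N ∷ x ∷ B)) here (nonLow-⇔ here)
    λ ¬low → ¬low (recordLow-head N (x ∷ B))

  -- At the front `N` has nothing to its left, so it is a record low, and `x < N` keeps it from
  -- being the smallest: the exponent of `b` grows by one.
  lows*-front : lows* (N ∷ x ∷ B) ≡ suc (lows* (x ∷ B))
  lows*-front = count-accept (low*? (x ∷ B)) (low*? (N ∷ x ∷ B)) here (low*-⇔ here)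
    (recordLow-head N (x ∷ B) , λ { (_ ∷ N≤x ∷ _) → ℕ.<⇒≱ x<N N≤x })

  -- Behind `x` the new element has a smaller one to its left: the exponent of `a` grows by one.
  nonLows-later : Insertion N B B′ → nonLows (x ∷ B′) ≡ suc (nonLows (x ∷ B))
  nonLows-later {B′ = B′} p =
    count-accept (nonLow? (x ∷ B)) (nonLow? (x ∷ B′)) (there p) (nonLow-⇔ (there p)) (not-recordLow {B = B′} x<N)

  lows*-later : Insertion N B B′ → lows* (x ∷ B′) ≡ lows* (x ∷ B)
  lows*-later {B′ = B′} p =
    count-reject (low*? (x ∷ B)) (low*? (x ∷ B′)) (there p) (low*-⇔ (there p))
      λ (low , _) → not-recordLow {B = B′} x<N low

nonLows-singleton : ∀ N → nonLows [ N ] ≡ 0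
nonLows-singleton N = cong length (List.filter-reject (nonLow? [ N ]) {xs = []} λ ¬low → ¬low (recordLow-head N []))

-- `N` is a record low but also the smallest of its block, so opening a block has weight 1.
lows*-singleton : ∀ N → lows* [ N ] ≡ 0
lows*-singleton N = cong length (List.filter-reject (low*? [ N ]) {xs = []} λ (_ , ¬sm) → ¬sm (ℕ.≤-refl ∷ []))

-- Weighted sums of Lah distributions

module Weighted {c ℓ : Level} (R : CommutativeRing c ℓ) where

  open CommutativeRing R
    hiding (zero)
    renaming (refl to ≈-refl; sym to ≈-sym; trans to ≈-trans; reflexive to ≈-reflexive; setoid to ≈-setoid)
  open GeneralizedLah R
  open import Algebra.Properties.CommutativeMonoid.Mult +-commutativeMonoid
    using (×-congʳ; ×-congˡ; ×-homo-+; ×-distrib-+)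
  open import Algebra.Properties.CommutativeMonoid.Sum *-commutativeMonoid
    using () renaming (sum-cong-≋ to product-cong)
  open import Algebra.Properties.CommutativeSemigroup *-commutativeSemigroup
    using (interchange; x∙yz≈y∙xz)
  open import Algebra.Properties.Semiring.Exp semiring using (_^_; ^-homo-*)
  open import Algebra.Properties.Semiring.Mult semiring using (×-comm-*; ×-assoc-*)
  open import Algebra.Properties.Semiring.Sum semiring
    using (sum-cong-≋; ∑-distrib-+; ∑-comm; *-distribˡ-sum)
  open import Algebra.Solver.Ring.NaturalCoefficients.Default commutativeSemiring
    using (solve; _:=_; _:+_; _:*_)
  open import Relation.Binary.Reasoning.Setoid ≈-setoid

  -- Sums over lists and over initial segments

  listSum : List X → (X → Carrier) → Carrier
  listSum xs f = foldr _+_ 0# (map f xs)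

  listSum-cong : {f g : X → Carrier} (xs : List X) →
                 (∀ {x} → x ∈ xs → f x ≈ g x) → listSum xs f ≈ listSum xs g
  listSum-cong []       _   = ≈-refl
  listSum-cong (x ∷ xs) f≈g = +-cong (f≈g (here refl)) (listSum-cong xs (f≈g ∘ there))

  listSum-zero : {f : X → Carrier} (xs : List X) → (∀ {x} → x ∈ xs → f x ≈ 0#) → listSum xs f ≈ 0#
  listSum-zero []       _   = ≈-refl
  listSum-zero (x ∷ xs) f≈0 =
    ≈-trans (+-cong (f≈0 (here refl)) (listSum-zero xs (f≈0 ∘ there))) (+-identityˡ 0#)

  listSum-++ : (f : X → Carrier) (xs ys : List X) →
               listSum (xs ++ ys) f ≈ listSum xs f + listSum ys f
  listSum-++ f []       ys = ≈-sym (+-identityˡ _)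
  listSum-++ f (x ∷ xs) ys = ≈-trans (+-congˡ (listSum-++ f xs ys)) (≈-sym (+-assoc _ _ _))

  listSum-map : (f : Y → Carrier) (g : X → Y) (xs : List X) →
                listSum (map g xs) f ≡ listSum xs (f ∘ g)
  listSum-map f g xs = cong (foldr _+_ 0#) (sym (List.map-∘ xs))

  listSum-concatMap : (f : Y → Carrier) (g : X → List Y) (xs : List X) →
                      listSum (concatMap g xs) f ≈ listSum xs (λ x → listSum (g x) f)
  listSum-concatMap f g []       = ≈-refl
  listSum-concatMap f g (x ∷ xs) =
    ≈-trans (listSum-++ f (g x) (concatMap g xs)) (+-congˡ (listSum-concatMap f g xs))

  listSum-*ˡ : (k : Carrier) (f : X → Carrier) (xs : List X) →
               listSum xs (λ x → k * f x) ≈ k * listSum xs f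
  listSum-*ˡ k f []       = ≈-sym (zeroʳ k)
  listSum-*ˡ k f (x ∷ xs) = ≈-trans (+-congˡ (listSum-*ˡ k f xs)) (≈-sym (distribˡ k _ _))

  listSum-*ʳ : (k : Carrier) (f : X → Carrier) (xs : List X) →
               listSum xs (λ x → f x * k) ≈ listSum xs f * k
  listSum-*ʳ k f []       = ≈-sym (zeroˡ k)
  listSum-*ʳ k f (x ∷ xs) = ≈-trans (+-congˡ (listSum-*ʳ k f xs)) (≈-sym (distribʳ k _ _))

  listSum-const : (k : Carrier) (xs : List X) → listSum xs (λ _ → k) ≡ length xs · k
  listSum-const k []       = refl
  listSum-const k (x ∷ xs) = cong (k +_) (listSum-const k xs)

  listSum-↭ : (f : X → Carrier) {xs ys : List X} → xs ↭ ys → listSum xs f ≈ listSum ys f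
  listSum-↭ f xs↭ys = PermutationSetoid.foldr-commMonoid ≈-setoid +-isCommutativeMonoid
    (PermutationSetoid.map⁺ (setoid _) ≈-setoid (λ { refl → ≈-refl }) (↭⇒↭ₛ xs↭ys))

  listSum-filter : {P : Pred X 0ℓ} (P? : Decidable P) (f : X → Carrier) (xs : List X) →
                   listSum (filter P? xs) f ≈ listSum xs (λ x → if does (P? x) then f x else 0#)
  listSum-filter P? f [] = ≈-refl
  listSum-filter P? f (x ∷ xs) with P? x
  ... | yes _ = +-congˡ (listSum-filter P? f xs)
  ... | no _  = ≈-trans (listSum-filter P? f xs) (≈-sym (+-identityˡ _))

  ∑-cong : ∀ n (f g : ℕ → Carrier) → (∀ {i} → i < n → f i ≈ g i) →
           ∑[ i < n ] f (toℕ i) ≈ ∑[ i < n ] g (toℕ i)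
  ∑-cong n f g f≈g = sum-cong-≋ {n} λ i → f≈g (toℕ<n i)

  ∑-last : ∀ n (f : ℕ → Carrier) → ∑[ i ≤ n ] f (toℕ i) ≈ ∑[ i < n ] f (toℕ i) + f n
  ∑-last zero    f = ≈-trans (+-identityʳ _) (≈-sym (+-identityˡ _))
  ∑-last (suc n) f = ≈-trans (+-congˡ (∑-last n (f ∘ suc))) (≈-sym (+-assoc _ _ _))

  -- If f (n + 1) vanishes, so does the boundary term that an index shift creates.
  ∑-shift : ∀ n (f : ℕ → Carrier) → f (suc n) ≈ 0# →
            f 0 + ∑[ i ≤ n ] f (suc (toℕ i)) ≈ ∑[ i ≤ n ] f (toℕ i)
  ∑-shift n f f≈0 = begin
    ∑[ i ≤ suc n ] f (toℕ i)             ≈⟨ ∑-last (suc n) f ⟩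
    ∑[ i ≤ n ] f (toℕ i) + f (suc n)     ≈⟨ +-congˡ f≈0 ⟩
    ∑[ i ≤ n ] f (toℕ i) + 0#            ≈⟨ +-identityʳ _ ⟩
    ∑[ i ≤ n ] f (toℕ i)                 ∎

  module _ (a b : Carrier) where

    -- Weights, and the total weight of inserting one element

    blockWeight : Block → Carrier
    blockWeight B = a ^ nonLows B * b ^ lows* B

    weight : List Block → Carrier
    weight bs = a ^ nrec bs * b ^ rec* bs

    weight-∷ : ∀ B bs → weight (B ∷ bs) ≈ blockWeight B * weight bs
    weight-∷ B bs = ≈-trans
      (*-cong (^-homo-* a (nonLows B) (nrec bs)) (^-homo-* b (lows* B) (rec* bs)))
      (interchange _ _ _ _)

    weight-[] : weight [] ≈ 1#
    weight-[] = *-identityˡ 1#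

    blockWeight-[_] : ∀ N → blockWeight [ N ] ≈ 1#
    blockWeight-[ N ] rewrite nonLows-singleton N | lows*-singleton N = *-identityˡ 1#

    weight-append : ∀ bs → weight (bs ∷ʳ [ N ]) ≈ weight bs
    weight-append {N = N} [] =
      ≈-trans (weight-∷ [ N ] []) (≈-trans (*-congʳ blockWeight-[ N ]) (*-identityˡ _))
    weight-append (B ∷ bs) = ≈-trans (weight-∷ B (bs ∷ʳ _))
      (≈-trans (*-congˡ (weight-append bs)) (≈-sym (weight-∷ B bs)))

    -- The front position contributes a factor `b`, each of the `length B` positions behind an
    -- element a factor `a`.
    insert-weight : B ≢ [] → All (_< N) B →
                    listSum (insert N B) blockWeight ≈ (length B · a + b) * blockWeight B
    insert-weight {B = []}            B≢[] _  = contradiction refl B≢[]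
    insert-weight {B = x ∷ B} {N = N} _    <N = begin
      blockWeight (N ∷ x ∷ B) + listSum (map (x ∷_) (insert N B)) blockWeight
        ≈⟨ +-cong front (≈-trans (≈-reflexive (listSum-map blockWeight (x ∷_) (insert N B)))
             (listSum-cong (insert N B) (later ∘ ∈-insert⁻ B))) ⟩
      b * w + listSum (insert N B) (λ _ → a * w)
        ≡⟨ cong (b * w +_) (listSum-const (a * w) (insert N B)) ⟩
      b * w + length (insert N B) · (a * w)
        ≡⟨ cong (λ k → b * w + k · (a * w)) (insert-length N B) ⟩
      b * w + suc (length B) · (a * w)
        ≈⟨ +-congˡ (×-assoc-* (suc (length B)) a w) ⟨
      b * w + (suc (length B) · a) * w
        ≈⟨ solve 3 (λ a′ b w → b :* w :+ a′ :* w := (a′ :+ b) :* w) ≈-refl _ b w ⟩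
      (suc (length B) · a + b) * w ∎
      where
      w : Carrier
      w = blockWeight (x ∷ B)

      front : blockWeight (N ∷ x ∷ B) ≈ b * w
      front rewrite nonLows-front <N | lows*-front <N = x∙yz≈y∙xz _ b _

      later : Insertion N B B′ → blockWeight (x ∷ B′) ≈ a * w
      later p rewrite nonLows-later <N p | lows*-later <N p = *-assoc a _ _

    insertAny-weight : All (_≢ []) bs → All (All (_< N)) bs →
      listSum (insertAny N bs) weight ≈ (length (concat bs) · a + length bs · b) * weight bs
    insertAny-weight [] [] = ≈-sym (≈-trans (*-congʳ (+-identityˡ 0#)) (zeroˡ _))
    insertAny-weight {bs = B ∷ bs} {N = N} (≢[] ∷ ne) (<N ∷ <Ns) = begin
      listSum (map (_∷ bs) (insert N B) ++ map (B ∷_) (insertAny N bs)) weight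
        ≈⟨ listSum-++ weight (map (_∷ bs) (insert N B)) (map (B ∷_) (insertAny N bs)) ⟩
      listSum (map (_∷ bs) (insert N B)) weight + listSum (map (B ∷_) (insertAny N bs)) weight
        ≡⟨ cong₂ _+_ (listSum-map weight (_∷ bs) (insert N B)) (listSum-map weight (B ∷_) (insertAny N bs)) ⟩
      listSum (insert N B) (λ D → weight (D ∷ bs)) + listSum (insertAny N bs) (λ cs → weight (B ∷ cs))
        ≈⟨ +-cong (listSum-cong (insert N B) (λ {D} _ → weight-∷ D bs))
                  (listSum-cong (insertAny N bs) (λ {cs} _ → weight-∷ B cs)) ⟩
      listSum (insert N B) (λ D → blockWeight D * weight bs)
        + listSum (insertAny N bs) (λ cs → blockWeight B * weight cs)
        ≈⟨ +-cong (listSum-*ʳ (weight bs) blockWeight (insert N B))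
                  (listSum-*ˡ (blockWeight B) weight (insertAny N bs)) ⟩
      listSum (insert N B) blockWeight * weight bs + blockWeight B * listSum (insertAny N bs) weight
        ≈⟨ +-cong (*-congʳ (insert-weight ≢[] <N)) (*-congˡ (insertAny-weight ne <Ns)) ⟩
      (p · a + b) * blockWeight B * weight bs + blockWeight B * ((q · a + k · b) * weight bs)
        ≈⟨ solve 6 (λ pa b w v qa kb → (pa :+ b) :* w :* v :+ w :* ((qa :+ kb) :* v)
                                       := (pa :+ qa :+ (b :+ kb)) :* (w :* v))
             ≈-refl (p · a) b (blockWeight B) (weight bs) (q · a) (k · b) ⟩
      (p · a + q · a + suc k · b) * (blockWeight B * weight bs)
        ≈⟨ *-cong (+-congʳ (×-homo-+ a p q)) (weight-∷ B bs) ⟨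
      ((p ℕ.+ q) · a + suc k · b) * weight (B ∷ bs)
        ≡⟨ cong (λ n → (n · a + suc k · b) * weight (B ∷ bs)) (List.length-++ B) ⟨
      (length (concat (B ∷ bs)) · a + suc k · b) * weight (B ∷ bs) ∎
      where
      p q k : ℕ
      p = length B
      q = length (concat bs)
      k = length bs

    -- Weights of separated distributions

    separatedWeight : ℕ → List Block → Carrier
    separatedWeight r bs = if does (separated? r bs) then weight bs else 0#

    separatedWeight-yes : Separated r bs → separatedWeight r bs ≡ weight bs
    separatedWeight-yes {r} {bs} sep =
      cong (if_then weight bs else 0#) (dec-true (separated? r bs) sep)

    separatedWeight-no : ¬ Separated r bs → separatedWeight r bs ≡ 0#
    separatedWeight-no {r} {bs} ¬sep =
      cong (if_then weight bs else 0#) (dec-false (separated? r bs) ¬sep)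

    separatedWeight-append : ∀ r N bs → separatedWeight r (bs ∷ʳ [ N ]) ≈ separatedWeight r bs
    separatedWeight-append r N bs with separated? r bs
    ... | yes sep = ≈-trans (≈-reflexive (separatedWeight-yes (separated-append sep))) (weight-append bs)
    ... | no ¬sep = ≈-reflexive (separatedWeight-no (¬sep ∘ separated-unappend bs))

    -- The new element `suc M` lies outside `[r]`, so insertion neither creates nor destroys
    -- separation, and `insertAny-weight` applies with `M` elements in all.
    insertAny-separatedWeight : r ≤ M → LahPartition M bs →
      listSum (insertAny (suc M) bs) (separatedWeight r) ≈ (M · a + length bs · b) * separatedWeight r bs
    insertAny-separatedWeight {r = r} {M = M} {bs = bs} r≤M L with separated? r bs
    ... | yes sep = begin
      listSum (insertAny (suc M) bs) (separatedWeight r)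
        ≈⟨ listSum-cong (insertAny (suc M) bs) (λ bs′∈ → ≈-reflexive
             (separatedWeight-yes (separated-insert (s≤s r≤M) (∈-insertAny⁻ bs bs′∈) sep))) ⟩
      listSum (insertAny (suc M) bs) weight
        ≈⟨ insertAny-weight (nonEmpty L) (elements-< L) ⟩
      (length (concat bs) · a + length bs · b) * weight bs
        ≡⟨ cong (λ n → (n · a + length bs · b) * weight bs) (LahPartition-size L) ⟩
      (M · a + length bs · b) * weight bs ∎
    ... | no ¬sep = ≈-trans
      (listSum-zero (insertAny (suc M) bs) λ bs′∈ → ≈-reflexive
        (separatedWeight-no (¬sep ∘ separated-remove (∈-insertAny⁻ bs bs′∈))))
      (≈-sym (zeroʳ _))

    -- 𝒢 a b n k r is the case M = n + r, K = k + r; the recurrences are simpler in M and K.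
    total : ℕ → ℕ → ℕ → Carrier
    total r M K = listSum (filter (separated? r) (lahDistributions M K)) weight

    -- Giving weight 0 to the non-separated distributions lets the sum run over all Lah
    -- distributions, where `lahDistributions-suc` applies.
    total≈ : ∀ r M K → total r M K ≈ listSum (lahDistributions M K) (separatedWeight r)
    total≈ r M K = listSum-filter (separated? r) weight (lahDistributions M K)

    -- A new singleton block changes neither weight nor separation. The sum over insertions is left
    -- unevaluated, as its value depends on whether `suc M` lies in `[r]`.
    total-suc : ∀ r M K → total r (suc M) (suc K) ≈ total r M K +
      listSum (lahDistributions M (suc K)) (λ bs → listSum (insertAny (suc M) bs) (separatedWeight r))
    total-suc r M K = begin
      total r (suc M) (suc K)
        ≈⟨ total≈ r (suc M) (suc K) ⟩
      listSum (lahDistributions (suc M) (suc K)) ω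
        ≈⟨ listSum-↭ ω (lahDistributions-suc M K) ⟩
      listSum (map (_∷ʳ [ suc M ]) (lahDistributions M K) ++ inserted) ω
        ≈⟨ listSum-++ ω (map (_∷ʳ [ suc M ]) (lahDistributions M K)) inserted ⟩
      listSum (map (_∷ʳ [ suc M ]) (lahDistributions M K)) ω + listSum inserted ω
        ≈⟨ +-cong
             (≈-trans (≈-reflexive (listSum-map ω (_∷ʳ [ suc M ]) (lahDistributions M K)))
                      (listSum-cong (lahDistributions M K) (λ {bs} _ → separatedWeight-append r (suc M) bs)))
             (listSum-concatMap ω (insertAny (suc M)) (lahDistributions M (suc K))) ⟩
      listSum (lahDistributions M K) ω + _
        ≈⟨ +-congʳ (total≈ r M K) ⟨
      total r M K + _ ∎
      where
      ω : List Block → Carrier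
      ω = separatedWeight r

      inserted : List (List Block)
      inserted = concatMap (insertAny (suc M)) (lahDistributions M (suc K))

    total-suc-≥ : ∀ M K → r ≤ M →
      total r (suc M) (suc K) ≈ total r M K + (M · a + suc K · b) * total r M (suc K)
    total-suc-≥ {r = r} M K r≤M = ≈-trans (total-suc r M K) $ +-congˡ $ begin
      listSum (lahDistributions M (suc K)) (λ bs → listSum (insertAny (suc M) bs) (separatedWeight r))
        ≈⟨ listSum-cong (lahDistributions M (suc K)) (λ {bs} bs∈ →
             let len , L = ∈-lahDistributions⁻ M (suc K) bs∈ in
             ≈-trans (insertAny-separatedWeight r≤M L)
                     (≈-reflexive (cong (λ k → (M · a + k · b) * separatedWeight r bs) len))) ⟩
      listSum (lahDistributions M (suc K)) (λ bs → (M · a + suc K · b) * separatedWeight r bs)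
        ≈⟨ listSum-*ˡ _ (separatedWeight r) (lahDistributions M (suc K)) ⟩
      (M · a + suc K · b) * listSum (lahDistributions M (suc K)) (separatedWeight r)
        ≈⟨ *-congˡ (total≈ r M (suc K)) ⟨
      (M · a + suc K · b) * total r M (suc K) ∎

    -- Here `suc M` still belongs to `[r]`, so each insertion unites it with another element of
    -- `[r]` and has weight 0.
    total-suc-< : ∀ M K → M < r → total r (suc M) (suc K) ≈ total r M K
    total-suc-< {r = r} M K M<r = ≈-trans (total-suc r M K) $ ≈-trans
      (+-congˡ (listSum-zero (lahDistributions M (suc K)) λ {bs} bs∈ →
        listSum-zero (insertAny (suc M) bs) λ bs′∈ → ≈-reflexive
          (separatedWeight-no (not-separated-insert
            (proj₂ (∈-lahDistributions⁻ M (suc K) bs∈)) (∈-insertAny⁻ bs bs′∈) M<r))))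
      (+-identityʳ _)

    -- Boundary values

    total-empty : ∀ r M K → (∀ {bs} → length bs ≡ K → ¬ LahPartition M bs) → total r M K ≈ 0#
    total-empty r M K none = ≈-trans (total≈ r M K) $ listSum-zero (lahDistributions M K) λ bs∈ →
      let len , L = ∈-lahDistributions⁻ M K bs∈ in contradiction L (none len)

    total-0-suc : ∀ r K → total r 0 (suc K) ≈ 0#
    total-0-suc r K = total-empty r 0 (suc K) λ
      { {[] ∷ _}      _ L → All.head (nonEmpty L) refl
      ; {(_ ∷ _) ∷ _} _ L → ℕ.1+n≢0 (LahPartition-size L) }

    total-suc-0 : ∀ r M → total r (suc M) 0 ≈ 0#
    total-suc-0 r M = total-empty r (suc M) 0 λ { {[]} _ L → ℕ.0≢1+n (LahPartition-size L) }

    total-0-0 : ∀ r → total r 0 0 ≈ 1#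
    total-0-0 r = begin
      total r 0 0                  ≈⟨ total≈ r 0 0 ⟩
      separatedWeight r [] + 0#    ≈⟨ +-identityʳ _ ⟩
      separatedWeight r []         ≡⟨ separatedWeight-yes (separated⁺ r λ _ _ ()) ⟩
      weight []                    ≈⟨ weight-[] ⟩
      1#                           ∎

    -- As long as all elements lie in `[r]`, each has to open a block, so only the distribution into
    -- singletons counts.
    total-diagonal : ∀ M → M ≤ r → total r M M ≈ 1#
    total-diagonal {r = r} zero    _   = total-0-0 r
    total-diagonal         (suc M) M<r = ≈-trans (total-suc-< M M M<r) (total-diagonal M (ℕ.<⇒≤ M<r))

    total-below-diagonal : M ≤ r → K < M → total r M K ≈ 0#
    total-below-diagonal {M = suc M} {r = r} {K = zero} _ _ = total-suc-0 r M
    total-below-diagonal {M = suc M} {K = suc K} M<r (s≤s K<M) =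
      ≈-trans (total-suc-< M K M<r) (total-below-diagonal (ℕ.<⇒≤ M<r) K<M)

    -- The elements of `[r]` need `r` different blocks. In place of a pigeonhole argument, the
    -- recurrence carries the vanishing upwards from `r` elements.
    total-few-blocks : ∀ n → K < r → total r (n ℕ.+ r) K ≈ 0#
    total-few-blocks zero K<r = total-below-diagonal ℕ.≤-refl K<r
    total-few-blocks {K = zero}  {r = r} (suc n) _   = total-suc-0 r (n ℕ.+ r)
    total-few-blocks {K = suc K} {r = r} (suc n) K<r = begin
      total r (suc (n ℕ.+ r)) (suc K)
        ≈⟨ total-suc-≥ (n ℕ.+ r) K (ℕ.m≤n+m r n) ⟩
      total r (n ℕ.+ r) K + _ * total r (n ℕ.+ r) (suc K)
        ≈⟨ +-cong (total-few-blocks n (ℕ.<⇒≤ K<r)) (*-congˡ (total-few-blocks n K<r)) ⟩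
      0# + _ * 0#
        ≈⟨ ≈-trans (+-identityˡ _) (zeroʳ _) ⟩
      0# ∎

    total-many-blocks : M < K → total r M K ≈ 0#
    total-many-blocks {M = zero}  {K = suc K} {r = r} _ = total-0-suc r K
    total-many-blocks {M = suc M} {K = suc K} {r = r} (s≤s M<K) with r ℕ.≤? M
    ... | no r≰M  = ≈-trans (total-suc-< M K (ℕ.≰⇒> r≰M)) (total-many-blocks M<K)
    ... | yes r≤M = begin
      total r (suc M) (suc K)
        ≈⟨ total-suc-≥ M K r≤M ⟩
      total r M K + _ * total r M (suc K)
        ≈⟨ +-cong (total-many-blocks M<K) (*-congˡ (total-many-blocks (ℕ.m≤n⇒m≤1+n M<K))) ⟩
      0# + _ * 0#
        ≈⟨ ≈-trans (+-identityˡ _) (zeroʳ _) ⟩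
      0# ∎

    -- The weight of all ways to insert the next element without opening a block,
    -- for a distribution counted by 𝒢 a b m j r.
    rate : ℕ → ℕ → ℕ → Carrier
    rate r m j = (m ℕ.+ r) · a + (j ℕ.+ r) · b

    -- The recurrence of the generalized r-Lah numbers

    𝒢-0-0 : ∀ r → 𝒢 a b 0 0 r ≈ 1#
    𝒢-0-0 r = total-diagonal r ℕ.≤-refl

    𝒢-vanishes : ∀ {n k} r → n < k → 𝒢 a b n k r ≈ 0#
    𝒢-vanishes r n<k = total-many-blocks {r = r} (ℕ.+-monoˡ-< r n<k)

    𝒢-suc-suc : ∀ n k r → 𝒢 a b (suc n) (suc k) r ≈ 𝒢 a b n k r + rate r n (suc k) * 𝒢 a b n (suc k) r
    𝒢-suc-suc n k r = total-suc-≥ (n ℕ.+ r) (k ℕ.+ r) (ℕ.m≤n+m r n)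

    -- The recurrence without its block-opening term. For positive `r` that term vanishes, as it has
    -- too few blocks for `[r]`; for `r = 0` both sides are zero, at `n = 0` because the rate is
    -- zero.
    𝒢-suc-0 : ∀ n r → 𝒢 a b (suc n) 0 r ≈ rate r n 0 * 𝒢 a b n 0 r
    𝒢-suc-0 zero zero = ≈-trans (total-suc-0 0 0) (≈-sym (≈-trans (*-congʳ (+-identityˡ 0#)) (zeroˡ _)))
    𝒢-suc-0 (suc n) zero = ≈-trans (total-suc-0 0 (suc (n ℕ.+ 0)))
      (≈-sym (≈-trans (*-congˡ (total-suc-0 0 (n ℕ.+ 0))) (zeroʳ _)))
    𝒢-suc-0 n (suc r) = begin
      𝒢 a b (suc n) 0 (suc r)
        ≈⟨ total-suc-≥ (n ℕ.+ suc r) r (ℕ.m≤n+m (suc r) n) ⟩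
      total (suc r) (n ℕ.+ suc r) r + rate (suc r) n 0 * 𝒢 a b n 0 (suc r)
        ≈⟨ +-congʳ (total-few-blocks {K = r} n ℕ.≤-refl) ⟩
      0# + rate (suc r) n 0 * 𝒢 a b n 0 (suc r)
        ≈⟨ +-identityˡ _ ⟩
      rate (suc r) n 0 * 𝒢 a b n 0 (suc r) ∎

    -- The weight of all ways to insert n further elements into a distribution at which the
    -- next one has rate s: it can open a block, and the rate then grows by a + b, or join
    -- one, and the rate grows by a.
    extensions : ℕ → Carrier → Carrier
    extensions zero    s = 1#
    extensions (suc n) s = extensions n (s + a + b) + s * extensions n (s + a)

    extensions-cong : ∀ n {s t} → s ≈ t → extensions n s ≈ extensions n t
    extensions-cong zero    _   = ≈-refl
    extensions-cong (suc n) s≈t = +-cong (extensions-cong n (+-congʳ (+-congʳ s≈t)))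
      (*-cong s≈t (extensions-cong n (+-congʳ s≈t)))

    -- Induction on `n` for all `m`: the first insertion turns `m` into `suc m`. Regrouping the
    -- terms of the recurrence by the number of blocks before this insertion yields the recursion of
    -- `extensions`.
    rowSum-extensions : ∀ r n m → rowSum a b (n ℕ.+ m) r ≈
                        ∑[ j ≤ m ] (𝒢 a b m (toℕ j) r * extensions n (rate r m (toℕ j)))
    rowSum-extensions r zero m = sum-cong-≋ {suc m} λ j → ≈-sym (*-identityʳ (𝒢 a b m (toℕ j) r))
    rowSum-extensions r (suc n) m = begin
      rowSum a b (suc n ℕ.+ m) r
        ≡⟨ cong (λ k → rowSum a b k r) (sym (ℕ.+-suc n m)) ⟩
      rowSum a b (n ℕ.+ suc m) r
        ≈⟨ rowSum-extensions r n (suc m) ⟩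
      𝒢 a b (suc m) 0 r * E 0 + ∑[ j ≤ m ] (𝒢 a b (suc m) (suc (toℕ j)) r * E (suc (toℕ j)))
        ≈⟨ +-cong (*-congʳ (𝒢-suc-0 m r))
                  (∑-cong (suc m) (λ j → 𝒢 a b (suc m) (suc j) r * E (suc j)) (λ j → opened j + joined (suc j))
                    λ {j} _ → ≈-trans (*-congʳ (𝒢-suc-suc m j r)) (distribʳ (E (suc j)) _ _)) ⟩
      joined 0 + ∑[ j ≤ m ] (opened (toℕ j) + joined (suc (toℕ j)))
        ≈⟨ +-congˡ (∑-distrib-+ {suc m} (opened ∘ toℕ) (joined ∘ suc ∘ toℕ)) ⟩
      joined 0 + (∑[ j ≤ m ] opened (toℕ j) + ∑[ j ≤ m ] joined (suc (toℕ j)))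
        ≈⟨ solve 3 (λ x y z → x :+ (y :+ z) := y :+ (x :+ z)) ≈-refl (joined 0) _ _ ⟩
      ∑[ j ≤ m ] opened (toℕ j) + (joined 0 + ∑[ j ≤ m ] joined (suc (toℕ j)))
        -- The sum of `joined` can end at `m` because `𝒢 a b m (suc m) r` is zero.
        ≈⟨ +-congˡ (∑-shift m joined joined-vanishes) ⟩
      ∑[ j ≤ m ] opened (toℕ j) + ∑[ j ≤ m ] joined (toℕ j)
        ≈⟨ ∑-distrib-+ {suc m} (opened ∘ toℕ) (joined ∘ toℕ) ⟨
      ∑[ j ≤ m ] (opened (toℕ j) + joined (toℕ j))
        ≈⟨ ∑-cong (suc m) (λ j → opened j + joined j) (λ j → 𝒢 a b m j r * extensions (suc n) (rate r m j))
             (λ {j} _ → step j) ⟩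
      ∑[ j ≤ m ] (𝒢 a b m (toℕ j) r * extensions (suc n) (rate r m (toℕ j))) ∎
      where
      E opened joined : ℕ → Carrier
      E j      = extensions n (rate r (suc m) j)
      opened j = 𝒢 a b m j r * E (suc j)
      joined j = rate r m j * 𝒢 a b m j r * E j

      joined-vanishes : joined (suc m) ≈ 0#
      joined-vanishes = ≈-trans (*-congʳ (≈-trans (*-congˡ (𝒢-vanishes r (ℕ.n<1+n m))) (zeroʳ _))) (zeroˡ _)

      step : ∀ j → opened j + joined j ≈ 𝒢 a b m j r * extensions (suc n) (rate r m j)
      step j = begin
        opened j + joined j
          ≈⟨ solve 4 (λ s g e f → g :* e :+ s :* g :* f := g :* (e :+ s :* f)) ≈-refl _ _ _ _ ⟩
        𝒢 a b m j r * (E (suc j) + rate r m j * E j)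
          -- Passing from `m` to `suc m` raises the rate by `a`, passing from `j` to `suc j` raises
          -- it by `b`.
          ≈⟨ *-congˡ (+-cong
               (extensions-cong n (solve 4 (λ a b x y → (a :+ x) :+ (b :+ y) := x :+ y :+ a :+ b)
                 ≈-refl a b ((m ℕ.+ r) · a) ((j ℕ.+ r) · b)))
               (*-congˡ (extensions-cong n (solve 3 (λ a x y → (a :+ x) :+ y := x :+ y :+ a)
                 ≈-refl a ((m ℕ.+ r) · a) ((j ℕ.+ r) · b))))) ⟩
        𝒢 a b m j r * extensions (suc n) (rate r m j) ∎

    -- Binomial convolution with rising factorials of step a

    rising : ℕ → Carrier → Carrier
    rising k s = ∏[ l < k ] (toℕ l · a + s)

    -- The factor for `l = 0` is split off, and the remaining ones are read as starting from
    -- `s + a`.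
    rising-suc : ∀ k s → rising (suc k) s ≈ s * rising k (s + a)
    rising-suc k s = *-cong (+-identityˡ s) (product-cong {k} λ l →
      solve 3 (λ a x s → a :+ x :+ s := x :+ (s :+ a)) ≈-refl a (toℕ l · a) s)

    binomialTerm : ℕ → Carrier → (ℕ → Carrier) → ℕ → Carrier
    binomialTerm n s f i = (n C i) · (f i * rising (n ∸ i) s)

    convolve : ℕ → Carrier → (ℕ → Carrier) → Carrier
    convolve n s f = ∑[ i ≤ n ] binomialTerm n s f (toℕ i)

    convolve-cong : ∀ n s f g → (∀ i → f i ≈ g i) → convolve n s f ≈ convolve n s g
    convolve-cong n s f g f≈g = ∑-cong (suc n) (binomialTerm n s f) (binomialTerm n s g)
      λ {i} _ → ×-congʳ (n C i) (*-congʳ (f≈g i))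

    convolve-+ : ∀ n s f g → convolve n s (λ i → f i + g i) ≈ convolve n s f + convolve n s g
    convolve-+ n s f g = ≈-trans
      (∑-cong (suc n) (binomialTerm n s (λ i → f i + g i)) (λ i → binomialTerm n s f i + binomialTerm n s g i)
        λ {i} _ → ≈-trans (×-congʳ (n C i) (distribʳ (rising (n ∸ i) s) (f i) (g i))) (×-distrib-+ _ _ (n C i)))
      (∑-distrib-+ {suc n} (binomialTerm n s f ∘ toℕ) (binomialTerm n s g ∘ toℕ))

    convolve-* : ∀ n s x f → convolve n s (λ i → x * f i) ≈ x * convolve n s f
    convolve-* n s x f = ≈-trans
      (∑-cong (suc n) (binomialTerm n s (λ i → x * f i)) (λ i → x * binomialTerm n s f i)
        λ {i} _ → ≈-trans (×-congʳ (n C i) (*-assoc x (f i) (rising (n ∸ i) s))) (≈-sym (×-comm-* (n C i) x _)))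
      (≈-sym (*-distribˡ-sum {suc n} x (binomialTerm n s f ∘ toℕ)))

    -- Of the two sums from Pascal's rule, one has `f` shifted; the other has one more factor in
    -- each product, and taking off the first factor `s` leaves products that start at `s + a`.
    convolve-suc : ∀ n s f → convolve (suc n) s f ≈ convolve n s (f ∘ suc) + s * convolve n (s + a) f
    convolve-suc n s f = begin
      -- `old 0` is the term at 0, because `suc n C 0` and `n C 0` both compute to 1.
      old 0 + ∑[ i ≤ n ] binomialTerm (suc n) s f (suc (toℕ i))
        ≈⟨ +-congˡ (∑-cong (suc n) (binomialTerm (suc n) s f ∘ suc) (λ i → new i + old (suc i)) λ {i} _ →
             ≈-trans (×-congˡ (sym (nCk+nC[k+1]≡[n+1]C[k+1] n i))) (×-homo-+ _ (n C i) (n C suc i))) ⟩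
      old 0 + ∑[ i ≤ n ] (new (toℕ i) + old (suc (toℕ i)))
        ≈⟨ +-congˡ (∑-distrib-+ {suc n} (new ∘ toℕ) (old ∘ suc ∘ toℕ)) ⟩
      old 0 + (convolve n s (f ∘ suc) + ∑[ i ≤ n ] old (suc (toℕ i)))
        ≈⟨ solve 3 (λ x y z → x :+ (y :+ z) := y :+ (x :+ z)) ≈-refl (old 0) _ _ ⟩
      convolve n s (f ∘ suc) + (old 0 + ∑[ i ≤ n ] old (suc (toℕ i)))
        ≈⟨ +-congˡ (∑-shift n old (×-congˡ (k>n⇒nCk≡0 (ℕ.n<1+n n)))) ⟩
      convolve n s (f ∘ suc) + ∑[ i ≤ n ] old (toℕ i)
        ≈⟨ +-congˡ (≈-trans
             (∑-cong (suc n) old (λ i → s * binomialTerm n (s + a) f i) λ { (s≤s i≤n) → old≈ i≤n })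
             (≈-sym (*-distribˡ-sum {suc n} s (binomialTerm n (s + a) f ∘ toℕ)))) ⟩
      convolve n s (f ∘ suc) + s * convolve n (s + a) f ∎
      where
      -- Pascal's rule splits the term i + 1 of the left-hand side into new i + old (i + 1).
      new old : ℕ → Carrier
      new   = binomialTerm n s (f ∘ suc)
      old i = (n C i) · (f i * rising (suc n ∸ i) s)

      old≈ : ∀ {i} → i ≤ n → old i ≈ s * binomialTerm n (s + a) f i
      old≈ {i} i≤n = begin
        (n C i) · (f i * rising (suc n ∸ i) s)
          -- With truncated subtraction this needs `i ≤ n`, which holds once the vanishing of
          -- `n C suc n` has closed the range at `n`.
          ≡⟨ cong (λ k → (n C i) · (f i * rising k s)) (ℕ.+-∸-assoc 1 i≤n) ⟩
        (n C i) · (f i * rising (suc (n ∸ i)) s)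
          ≈⟨ ×-congʳ (n C i) (≈-trans (*-congˡ (rising-suc (n ∸ i) s)) (x∙yz≈y∙xz (f i) s _)) ⟩
        (n C i) · (s * (f i * rising (n ∸ i) (s + a)))
          ≈⟨ ×-comm-* (n C i) s _ ⟨
        s * binomialTerm n (s + a) f i ∎

    -- Induction on `n` for all `s` and `t`. Of the factor `s + t`, the part `t` combines with the
    -- block-opening term into `extensions (suc i) t` under the sum; the part `s` gives the second
    -- term of `convolve-suc`.
    extensions-+ : ∀ n s t → extensions n (s + t) ≈ convolve n s (λ i → extensions i t)
    extensions-+ zero s t = ≈-sym
      (≈-trans (+-identityʳ _) (≈-trans (+-identityʳ _) (*-identityˡ 1#)))
    extensions-+ (suc n) s t = begin
      extensions n (s + t + a + b) + (s + t) * extensions n (s + t + a)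
        ≈⟨ +-cong (extensions-cong n (solve 4 (λ s t a b → s :+ t :+ a :+ b := s :+ (t :+ a :+ b)) ≈-refl s t a b))
             (distribʳ _ s t) ⟩
      extensions n (s + (t + a + b)) + (s * extensions n (s + t + a) + t * extensions n (s + t + a))
        -- The increment `a` goes to `s` in the product with `s`, and to `t` in the product with
        -- `t`.
        ≈⟨ +-congˡ (+-cong
             (*-congˡ (extensions-cong n (solve 3 (λ s t a → s :+ t :+ a := s :+ a :+ t) ≈-refl s t a)))
             (*-congˡ (extensions-cong n (+-assoc s t a)))) ⟩
      extensions n (s + (t + a + b)) + (s * extensions n (s + a + t) + t * extensions n (s + (t + a)))
        ≈⟨ +-cong (extensions-+ n s (t + a + b))
             (+-cong (*-congˡ (extensions-+ n (s + a) t)) (*-congˡ (extensions-+ n s (t + a)))) ⟩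
      convolve n s (λ i → extensions i (t + a + b))
        + (s * convolve n (s + a) (λ i → extensions i t) + t * convolve n s (λ i → extensions i (t + a)))
        ≈⟨ solve 3 (λ x y z → x :+ (y :+ z) := x :+ z :+ y) ≈-refl _ _ _ ⟩
      convolve n s (λ i → extensions i (t + a + b)) + t * convolve n s (λ i → extensions i (t + a))
        + s * convolve n (s + a) (λ i → extensions i t)
        ≈⟨ +-congʳ (+-congˡ (convolve-* n s t (λ i → extensions i (t + a)))) ⟨
      convolve n s (λ i → extensions i (t + a + b)) + convolve n s (λ i → t * extensions i (t + a))
        + s * convolve n (s + a) (λ i → extensions i t)
        ≈⟨ +-congʳ (convolve-+ n s (λ i → extensions i (t + a + b)) (λ i → t * extensions i (t + a))) ⟨
      convolve n s (λ i → extensions (suc i) t) + s * convolve n (s + a) (λ i → extensions i t)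
        ≈⟨ convolve-suc n s (λ i → extensions i t) ⟨
      convolve (suc n) s (λ i → extensions i t) ∎

    -- With `r = m = 0` the insertions start from the empty distribution, which has weight 1 and
    -- rate 0.
    extensions-0 : ∀ n → extensions n 0# ≈ rowSum a b n 0
    extensions-0 n = ≈-sym $ begin
      rowSum a b n 0
        ≡⟨ cong (λ k → rowSum a b k 0) (sym (ℕ.+-identityʳ n)) ⟩
      rowSum a b (n ℕ.+ 0) 0
        ≈⟨ rowSum-extensions 0 n 0 ⟩
      𝒢 a b 0 0 0 * extensions n (0# + 0#) + 0#
        ≈⟨ +-identityʳ _ ⟩
      𝒢 a b 0 0 0 * extensions n (0# + 0#)
        ≈⟨ *-cong (𝒢-0-0 0) (extensions-cong n (+-identityˡ 0#)) ⟩
      1# * extensions n 0#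
        ≈⟨ *-identityˡ _ ⟩
      extensions n 0# ∎

    extensions-convolve : ∀ n s → extensions n s ≈ convolve n s (λ i → rowSum a b i 0)
    extensions-convolve n s = begin
      extensions n s                             ≈⟨ extensions-cong n (+-identityʳ s) ⟨
      extensions n (s + 0#)                      ≈⟨ extensions-+ n s 0# ⟩
      convolve n s (λ i → extensions i 0#)       ≈⟨ convolve-cong n s _ (λ i → rowSum a b i 0) extensions-0 ⟩
      convolve n s (λ i → rowSum a b i 0)        ∎

    -- The rate at which `extensions` is expanded depends on `j`, so `j` is the outer index at
    -- first; the two sums are then exchanged.
    rowSum-+ : ∀ r n m → rowSum a b (n ℕ.+ m) r ≈
      ∑[ i ≤ n ] ∑[ j ≤ m ]
        ((n C toℕ i) · (𝒢 a b m (toℕ j) r * rowSum a b (toℕ i) 0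
          * ∏[ l < n ∸ toℕ i ] (toℕ l · a + (m ℕ.+ r) · a + (toℕ j ℕ.+ r) · b)))
    rowSum-+ r n m = begin
      rowSum a b (n ℕ.+ m) r
        ≈⟨ rowSum-extensions r n m ⟩
      ∑[ j ≤ m ] (𝒢 a b m (toℕ j) r * extensions n (rate r m (toℕ j)))
        ≈⟨ ∑-cong (suc m) (λ j → 𝒢 a b m j r * extensions n (rate r m j)) (λ j → ∑[ i ≤ n ] term j (toℕ i))
             (λ {j} _ → expand j) ⟩
      ∑[ j ≤ m ] ∑[ i ≤ n ] term (toℕ j) (toℕ i)
        ≈⟨ ∑-comm {suc m} {suc n} (λ j i → term (toℕ j) (toℕ i)) ⟩
      ∑[ i ≤ n ] ∑[ j ≤ m ] term (toℕ j) (toℕ i) ∎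
      where
      term : ℕ → ℕ → Carrier
      term j i = (n C i) · (𝒢 a b m j r * rowSum a b i 0
        * ∏[ l < n ∸ i ] (toℕ l · a + (m ℕ.+ r) · a + (j ℕ.+ r) · b))

      expand : ∀ j → 𝒢 a b m j r * extensions n (rate r m j) ≈ ∑[ i ≤ n ] term j (toℕ i)
      expand j = begin
        𝒢 a b m j r * extensions n (rate r m j)
          ≈⟨ *-congˡ (extensions-convolve n (rate r m j)) ⟩
        𝒢 a b m j r * convolve n (rate r m j) (λ i → rowSum a b i 0)
          ≈⟨ convolve-* n (rate r m j) (𝒢 a b m j r) (λ i → rowSum a b i 0) ⟨
        convolve n (rate r m j) (λ i → 𝒢 a b m j r * rowSum a b i 0)
          -- In `rising` the rate is a single summand of each factor; in `term` its two parts are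
          -- added one after the other.
          ≈⟨ ∑-cong (suc n) (binomialTerm n (rate r m j) (λ i → 𝒢 a b m j r * rowSum a b i 0)) (term j)
               (λ {i} _ → ×-congʳ (n C i) (*-congˡ (product-cong {n ∸ i} λ l →
                 ≈-sym (+-assoc (toℕ l · a) ((m ℕ.+ r) · a) ((j ℕ.+ r) · b))))) ⟩
        ∑[ i ≤ n ] term j (toℕ i) ∎

mainTheorem4 : ∀ {c ℓ} (R : CommutativeRing c ℓ) →
    let open CommutativeRing R
        open GeneralizedLah R
    in (a b : Carrier) (r n m : ℕ) →
       rowSum a b (n ℕ.+ m) r
         ≈ ∑[ i ≤ n ] ∑[ j ≤ m ]
             ((n C toℕ i) · (𝒢 a b m (toℕ j) r * rowSum a b (toℕ i) 0
               * ∏[ l < n ∸ toℕ i ]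
                   (toℕ l · a + (m ℕ.+ r) · a + (toℕ j ℕ.+ r) · b)))
mainTheorem4 R a b r n m = Weighted.rowSum-+ R a b r n m
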